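{- Let $\pi:\mathbb{N}_0\to\mathbb{N}_0$ be defined recursively by: $\pi(n)$ is the least non-negative integer $m$ such that for every $j\in\{0,\ldots,n-1\}$ we have $m\ne\pi(j)$, $m\ne\pi(j)+(n-j)$, $m\ne\pi(j)+2(n-j)$ and $m\ne\pi(j)+\frac{n-j}{2}$. Let $(a_n)_{n\in\mathbb{N}_0}$ be the increasing enumeration of $\{n\in\mathbb{N}_0\mid\pi(n)\ge n\}$ and $b_n=\pi(a_n)$. Then the limit $\lim_{n\to\infty}\frac{b_n}{a_n}$ does not exist (neither as a real number nor as $+\infty$).
   Context: The pairs $\{a_n,b_n\}$ are exactly the $P$-positions (up to order of coordinates) of the game $(1,2)\mathrm{GDWN}$: from $(x,y)\in\mathbb{N}_0^2$ a player may move to $(x-m,y-n)\in\mathbb{N}_0^2$ where $(m,n)\in\{(0,t),(t,0),(t,t),(t,2t),(2t,t)\}$ for some $t\in\mathbb{N}$; the player unable to move loses. -}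

module Defs where

open import Data.Nat using (ℕ; zero; suc; _+_; _*_; _∸_; _≤_; _<_; _≥_)
open import Data.Integer using (+_)
open import Data.Rational.Unnormalised using (ℚᵘ; mkℚᵘ; 0ℚᵘ; ∣_∣; _-_) renaming (_<_ to _<ℚ_)
open import Data.Product using (_×_; ∃)
open import Relation.Binary.PropositionalEquality using (_≡_; _≢_)
open import Relation.Nullary using (¬_)

-- m is an admissible value for π(n), given the values p(0..n-1):
-- m ≠ p j, m ≠ p j + (n-j), m ≠ p j + 2(n-j), m ≠ p j + (n-j)/2.
-- The last condition is written 2m ≠ 2 p j + (n-j), which is exactly
-- "m ≠ p j + (n-j)/2" for integer m (vacuous when n-j is odd).
Admissible : (ℕ → ℕ) → ℕ → ℕ → Set
Admissible p n m =
  ∀ j → j < n →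
    (m ≢ p j) × (m ≢ p j + (n ∸ j)) × (m ≢ p j + 2 * (n ∸ j))
      × (2 * m ≢ 2 * p j + (n ∸ j))

IsPi : (ℕ → ℕ) → Set
IsPi p = ∀ n → Admissible p n (p n) × (∀ m → m < p n → ¬ Admissible p n m)

IsIncEnum : (ℕ → ℕ) → (ℕ → ℕ) → Set
IsIncEnum p a =
  (∀ n → a n < a (suc n)) × (∀ k → (p k ≥ k → ∃ λ n → a n ≡ k) × (∀ n → a n ≡ k → p k ≥ k))

-- ratio b_{n+1} / a_{n+1} with b = p ∘ a (index shifted by one since a_0 = 0;
-- a (suc n) ≥ 1 as a is strictly increasing, so the denominator a (suc n) ∸ 1 + 1 = a (suc n)).
ratio : (ℕ → ℕ) → (ℕ → ℕ) → ℕ → ℚᵘ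
ratio p a n = mkℚᵘ (+ p (a (suc n))) (a (suc n) ∸ 1)

-- Cauchy sequence of rationals (equivalently: converges to a real number).
Cauchy : (ℕ → ℚᵘ) → Set
Cauchy r = ∀ ε → 0ℚᵘ <ℚ ε → ∃ λ N → ∀ m n → N ≤ m → N ≤ n → ∣ r m - r n ∣ <ℚ ε

TendsToInfinity : (ℕ → ℚᵘ) → Set
TendsToInfinity r = ∀ M → ∃ λ N → ∀ n → N ≤ n → M <ℚ r n

{-# OPTIONS --safe #-}
module Submission where

-- Let A = {n | π(n) ≥ n}.  The permutation π is an involution, because the set of moves is symmetric, so
-- the pairs are (a , b) with a ∈ A, b = π(a), and b, b − a, b − 2a, 2b − a are each injective in a.
-- Suppose b/a → L.  Then A has density α = L/(L+1), and the numbers b − a, |b − 2a|, 2b − a have densities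
-- δ = α/(L−1), α/|L−2|, ν = α/(2L−1).  Injectivity of b − a and of b − 2a means that the first two
-- densities are at most 1, which leaves only L ≥ 1 + √3 (or L = ∞).  For such L consider the points (x , y)
-- of A × A in a box inside x < y < 2x.  Each is covered by a line y − x = b − a, 2x − y = 2b − a or
-- 2y − x = 2b − a.  The lines of the last two kinds carry at most 2αν of the box in A × A.  The lines of the
-- first kind carry δα in A × all, of which at least δβ − β² (with β = 1 − α) is wasted on A × B, since a
-- point of B × B lies on at most one such line.  Hence α² ≤ δα − (δβ − β²) + 2αν, that is
-- α (2 − 2δ − 2ν) ≤ 1 − δ, which fails for L ≥ 1 + √3.
-- Instead of a real L, the numerical comparison is run for every interval of ratios ((j − 1)/G , (j + 2)/G);
-- all densities are integers in units of 1/Q and hold up to an additive constant in the counts.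

open import Defs
open import Data.Bool using (Bool; true; false; T; _∧_; _∨_)
open import Data.Empty using (⊥; ⊥-elim)
open import Data.Integer as ℤ using (_⊖_) renaming (+_ to pos)
import Data.Integer.Properties as ℤₚ
open import Data.List using ([]; _∷_)
open import Data.Nat
open import Data.Nat.DivMod using (m/n*n≤m; m≡m%n+[m/n]*n; m%n<n)
open import Data.Nat.Properties
open import Data.Nat.Tactic.RingSolver using (solve-∀; solve)
open import Data.Product using (_×_; _,_; ∃; proj₁; proj₂)
open import Data.Rational.Unnormalised as ℚ using (mkℚᵘ; *<*) renaming (_<_ to _<ℚ_)
open import Data.Sum using (_⊎_; inj₁; inj₂)
open import Data.Unit using (tt)
open import Function using (_∘_)
open import Relation.Binary.Definitions using (tri<; tri≈; tri>)
open import Relation.Binary.PropositionalEquality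
open import Relation.Nullary using (¬_; Dec; yes; no)
open import Relation.Nullary.Decidable using (_×-dec_)
open import Relation.Unary using (Decidable)

-- Linear inequalities are derived from a certificate: x ≤ y follows from p ≤ q when y ∸ x = q ∸ p.
≤-certificate : ∀ {x y p q} → p ≤ q → x + q ≡ y + p → x ≤ y
≤-certificate {x} {y} {p} {q} p≤q eq =
  +-cancelʳ-≤ q x y (≤-trans (≤-reflexive eq) (+-monoʳ-≤ y p≤q))

-- *-monoˡ-≤ and *-monoʳ-≤ with the statements unfolded, for the ring solver.
scaleˡ : ∀ k {m n} → m ≤ n → k * m ≤ k * n
scaleˡ = *-monoʳ-≤

scaleʳ : ∀ k {m n} → m ≤ n → m * k ≤ n * k
scaleʳ = *-monoˡ-≤

-- Finite sums and counting

∑ : ℕ → (ℕ → ℕ) → ℕ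
∑ zero    f = 0
∑ (suc n) f = ∑ n f + f n

∑-mono : ∀ n {f g} → (∀ i → i < n → f i ≤ g i) → ∑ n f ≤ ∑ n g
∑-mono zero    h = z≤n
∑-mono (suc n) h = +-mono-≤ (∑-mono n λ i i<n → h i (m≤n⇒m≤1+n i<n)) (h n ≤-refl)

∑-cong : ∀ n {f g} → (∀ i → f i ≡ g i) → ∑ n f ≡ ∑ n g
∑-cong zero    h = refl
∑-cong (suc n) h = cong₂ _+_ (∑-cong n h) (h n)

∑-+ : ∀ n f g → ∑ n (λ i → f i + g i) ≡ ∑ n f + ∑ n g
∑-+ zero    f g = refl
∑-+ (suc n) f g = trans (cong (_+ (f n + g n)) (∑-+ n f g)) (interchange (∑ n f) (∑ n g) (f n) (g n))
  where
  interchange : ∀ a b c d → (a + b) + (c + d) ≡ (a + c) + (b + d)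
  interchange = solve-∀

∑-*ˡ : ∀ n c f → ∑ n (λ i → c * f i) ≡ c * ∑ n f
∑-*ˡ zero    c f = sym (*-zeroʳ c)
∑-*ˡ (suc n) c f = trans (cong (_+ c * f n) (∑-*ˡ n c f)) (sym (*-distribˡ-+ c (∑ n f) (f n)))

∑-*ʳ : ∀ n f c → ∑ n (λ i → f i * c) ≡ ∑ n f * c
∑-*ʳ zero    f c = refl
∑-*ʳ (suc n) f c = trans (cong (_+ f n * c) (∑-*ʳ n f c)) (sym (*-distribʳ-+ c (∑ n f) (f n)))

∑-const : ∀ n c → ∑ n (λ _ → c) ≡ n * c
∑-const zero    c = refl
∑-const (suc n) c = trans (cong (_+ c) (∑-const n c)) (+-comm (n * c) c)

∑-swap : ∀ m n (f : ℕ → ℕ → ℕ) → ∑ m (λ i → ∑ n (f i)) ≡ ∑ n (λ j → ∑ m (λ i → f i j))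
∑-swap zero    n f = sym (trans (∑-const n 0) (*-zeroʳ n))
∑-swap (suc m) n f =
  trans (cong (_+ ∑ n (f m)) (∑-swap m n f)) (sym (∑-+ n (λ j → ∑ m (λ i → f i j)) (f m)))

∑-split : ∀ m n f → ∑ (m + n) f ≡ ∑ m f + ∑ n (λ i → f (m + i))
∑-split m zero    f = trans (cong (λ k → ∑ k f) (+-identityʳ m)) (sym (+-identityʳ _))
∑-split m (suc n) f rewrite +-suc m n | ∑-split m n f = +-assoc (∑ m f) _ _

∑-term : ∀ {n i} f → i < n → f i ≤ ∑ n f
∑-term {suc n} {i} f i<1+n with m≤n⇒m<n∨m≡n (≤-pred i<1+n)
... | inj₁ i<n  = ≤-trans (∑-term f i<n) (m≤m+n _ _)
... | inj₂ refl = m≤n+m _ _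

∑-monoˡ : ∀ {m n} f → m ≤ n → ∑ m f ≤ ∑ n f
∑-monoˡ {m} {n} f m≤n = subst (λ k → ∑ m f ≤ ∑ k f) (m+[n∸m]≡n m≤n)
  (≤-trans (m≤m+n _ _) (≤-reflexive (sym (∑-split m (n ∸ m) f))))

χ : ∀ {P : Set} → Dec P → ℕ
χ (yes _) = 1
χ (no _)  = 0

χ≤1 : ∀ {P : Set} (P? : Dec P) → χ P? ≤ 1
χ≤1 (yes _) = ≤-refl
χ≤1 (no _)  = z≤n

χ-true : ∀ {P : Set} (P? : Dec P) → P → χ P? ≡ 1
χ-true (yes _) h = refl
χ-true (no ¬h) h = ⊥-elim (¬h h)

χ-false : ∀ {P : Set} (P? : Dec P) → ¬ P → χ P? ≡ 0
χ-false (yes h) ¬h = ⊥-elim (¬h h)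
χ-false (no _)  _  = refl

# : {P : ℕ → Set} → Decidable P → ℕ → ℕ
# P? n = ∑ n (λ i → χ (P? i))

#-witness : ∀ {P : ℕ → Set} (P? : Decidable P) {n i} → i < n → P i → 1 ≤ # P? n
#-witness P? {n} {i} i<n h =
  ≤-trans (≤-reflexive (sym (χ-true (P? i) h))) (∑-term (λ i → χ (P? i)) i<n)

#-empty : ∀ {P : ℕ → Set} (P? : Decidable P) n → (∀ i → i < n → ¬ P i) → # P? n ≡ 0
#-empty P? n h = n≤0⇒n≡0 (≤-trans (∑-mono n {g = λ _ → 0} λ i i<n → ≤-reflexive (χ-false (P? i) (h i i<n)))
  (≤-reflexive (trans (∑-const n 0) (*-zeroʳ n))))

#-unique : ∀ {P : ℕ → Set} (P? : Decidable P) n →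
  (∀ i j → P i → P j → i ≡ j) → # P? n ≤ 1
#-unique P? zero    uniq = z≤n
#-unique P? (suc n) uniq with P? n
... | no _  = ≤-trans (≤-reflexive (+-identityʳ _)) (#-unique P? n uniq)
... | yes h = ≤-reflexive (cong (_+ 1) (#-empty P? n λ i i<n h′ → <-irrefl (uniq i n h′ h) i<n))

#-unique-≤χ : ∀ {P : ℕ → Set} {R : Set} (P? : Decidable P) (R? : Dec R) n →
  (∀ i j → P i → P j → i ≡ j) → (∀ i → i < n → P i → R) → # P? n ≤ χ R?
#-unique-≤χ P? (yes _) n uniq imp = #-unique P? n uniq
#-unique-≤χ P? (no ¬r) n uniq imp = ≤-reflexive (#-empty P? n λ i i<n h → ¬r (imp i i<n h))

χ-≤# : ∀ {P : ℕ → Set} {R : Set} (P? : Decidable P) (R? : Dec R) n →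
  (R → ∃ λ i → i < n × P i) → χ R? ≤ # P? n
χ-≤# P? (yes r) n imp with imp r
... | i , i<n , h = #-witness P? i<n h
χ-≤# P? (no _)  n imp = z≤n

#-injection : ∀ {P R : ℕ → Set} (P? : Decidable P) (R? : Decidable R) m n (f : ℕ → ℕ) →
  (∀ i → i < m → P i → f i < n × R (f i)) →
  (∀ i j → P i → P j → f i ≡ f j → i ≡ j) → # P? m ≤ # R? n
#-injection {P} {R} P? R? m n f into inj = begin
  # P? m                                    ≤⟨ ∑-mono m (λ i i<m → χ-≤# (λ j → M? i j) (P? i) n (hit i i<m)) ⟩
  ∑ m (λ i → ∑ n (λ j → χ (M? i j)))        ≡⟨ ∑-swap m n _ ⟩
  ∑ n (λ j → ∑ m (λ i → χ (M? i j)))        ≤⟨ ∑-mono n (λ j _ → #-unique-≤χ (λ i → M? i j) (R? j) m (uniq j) (λ { i _ (_ , _ , r) → r })) ⟩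
  # R? n                                    ∎
  where
  open ≤-Reasoning
  M? : ∀ i j → Dec (P i × f i ≡ j × R j)
  M? i j = P? i ×-dec (f i ≟ j) ×-dec R? j
  hit : ∀ i → i < m → P i → ∃ λ j → j < n × (P i × f i ≡ j × R j)
  hit i i<m h = f i , proj₁ (into i i<m h) , h , refl , proj₂ (into i i<m h)
  uniq : ∀ j i i′ → P i × f i ≡ j × R j → P i′ × f i′ ≡ j × R j → i ≡ i′
  uniq j i i′ (h , e , _) (h′ , e′ , _) = inj i i′ h h′ (trans e (sym e′))

#≤n : ∀ {P : ℕ → Set} (P? : Decidable P) n → # P? n ≤ n
#≤n P? n = ≤-trans (∑-mono n {g = λ _ → 1} (λ i _ → χ≤1 (P? i))) (≤-reflexive (trans (∑-const n 1) (*-identityʳ n)))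

#-pigeonhole : ∀ {P : ℕ → Set} (P? : Decidable P) m n (f : ℕ → ℕ) →
  (∀ i → i < m → P i → f i < n) →
  (∀ i j → P i → P j → f i ≡ f j → i ≡ j) → # P? m ≤ n
#-pigeonhole P? m n f into inj =
  ≤-trans (#-injection P? (_<? n) m n f (λ i i<m h → into i i<m h , into i i<m h) inj) (#≤n (_<? n) n)

#-union : ∀ {P R S : ℕ → Set} (P? : Decidable P) (R? : Decidable R) (S? : Decidable S) n →
  (∀ i → i < n → P i → R i ⊎ S i) → # P? n ≤ # R? n + # S? n
#-union P? R? S? n h = ≤-trans (∑-mono n λ i i<n → χ-⊎ (P? i) (R? i) (S? i) (h i i<n))
  (≤-reflexive (∑-+ n (λ i → χ (R? i)) (λ i → χ (S? i))))
  where
  χ-⊎ : ∀ {P R S : Set} (P? : Dec P) (R? : Dec R) (S? : Dec S) → (P → R ⊎ S) → χ P? ≤ χ R? + χ S?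
  χ-⊎ (no _)  R? S? f = z≤n
  χ-⊎ (yes h) R? S? f with f h
  ... | inj₁ r = ≤-trans (≤-reflexive (sym (χ-true R? r))) (m≤m+n _ _)
  ... | inj₂ s = ≤-trans (≤-reflexive (sym (χ-true S? s))) (m≤n+m _ _)

#-<-≤ : ∀ k n → # (_<? k) n ≤ k
#-<-≤ k n = #-pigeonhole (_<? k) n k (λ i → i) (λ _ _ i<k → i<k) (λ _ _ _ _ e → e)

-- The permutation π as the kernel of the game

-- The moves of Admissible from (n , m) into column j, with all subtractions cleared.
Hit : (ℕ → ℕ) → ℕ → ℕ → ℕ → Set
Hit p n m j = (m ≡ p j) ⊎ (m + j ≡ p j + n) ⊎ (m + 2 * j ≡ p j + 2 * n) ⊎ (2 * m + j ≡ 2 * p j + n)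

admissible⇒¬hit : ∀ {p n m} → Admissible p n m → ∀ j → j < n → ¬ Hit p n m j
admissible⇒¬hit {p} {n} {m} adm j j<n hit with n ∸ j | m+[n∸m]≡n (<⇒≤ j<n) | adm j j<n
... | t | refl | h₀ , h₁ , h₂ , h₃ with hit
... | inj₁ e               = h₀ e
... | inj₂ (inj₁ e)        = h₁ (+-cancelʳ-≡ j _ _ (trans e (eq (p j) j t)))
  where eq : ∀ q j t → q + (j + t) ≡ q + t + j
        eq = solve-∀
... | inj₂ (inj₂ (inj₁ e)) = h₂ (+-cancelʳ-≡ (2 * j) _ _ (trans e (eq (p j) j t)))
  where eq : ∀ q j t → q + 2 * (j + t) ≡ q + 2 * t + 2 * j
        eq = solve-∀
... | inj₂ (inj₂ (inj₂ e)) = h₃ (+-cancelʳ-≡ j _ _ (trans e (eq (p j) j t)))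
  where eq : ∀ q j t → 2 * q + (j + t) ≡ 2 * q + t + j
        eq = solve-∀

¬hit⇒admissible : ∀ {p n m} → (∀ j → j < n → ¬ Hit p n m j) → Admissible p n m
¬hit⇒admissible {p} {n} {m} ¬hit j j<n with n ∸ j | m+[n∸m]≡n (<⇒≤ j<n) | ¬hit j j<n
... | t | refl | h =
  h ∘ inj₁ ,
  (λ { refl → h (inj₂ (inj₁ (eq₁ (p j) j t))) }) ,
  (λ { refl → h (inj₂ (inj₂ (inj₁ (eq₂ (p j) j t)))) }) ,
  (λ e → h (inj₂ (inj₂ (inj₂ (trans (cong (_+ j) e) (eq₁ (2 * p j) j t))))))
  where
  eq₁ : ∀ q j t → q + t + j ≡ q + (j + t)
  eq₁ = solve-∀
  eq₂ : ∀ q j t → q + 2 * t + 2 * j ≡ q + 2 * (j + t)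
  eq₂ = solve-∀

module Kernel (p : ℕ → ℕ) (isPi : IsPi p) where

  ¬hit : ∀ n j → j < n → ¬ Hit p n (p n) j
  ¬hit n = admissible⇒¬hit (proj₁ (isPi n))

  minimal : ∀ {n m} → m < p n → ¬ (∀ j → j < n → ¬ Hit p n m j)
  minimal {n} m<pn = proj₂ (isPi n) _ m<pn ∘ ¬hit⇒admissible

  injective : ∀ i j → p i ≡ p j → i ≡ j
  injective i j e with <-cmp i j
  ... | tri< i<j _ _ = ⊥-elim (¬hit j i i<j (inj₁ (sym e)))
  ... | tri≈ _ i≡j _ = i≡j
  ... | tri> _ _ j<i = ⊥-elim (¬hit i j j<i (inj₁ e))

  injective₁ : ∀ i j → p i + j ≡ p j + i → i ≡ j
  injective₁ i j e with <-cmp i j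
  ... | tri< i<j _ _ = ⊥-elim (¬hit j i i<j (inj₂ (inj₁ (sym e))))
  ... | tri≈ _ i≡j _ = i≡j
  ... | tri> _ _ j<i = ⊥-elim (¬hit i j j<i (inj₂ (inj₁ e)))

  injective₂ : ∀ i j → p i + 2 * j ≡ p j + 2 * i → i ≡ j
  injective₂ i j e with <-cmp i j
  ... | tri< i<j _ _ = ⊥-elim (¬hit j i i<j (inj₂ (inj₂ (inj₁ (sym e)))))
  ... | tri≈ _ i≡j _ = i≡j
  ... | tri> _ _ j<i = ⊥-elim (¬hit i j j<i (inj₂ (inj₂ (inj₁ e))))

  -- The set of moves is symmetric, so the kernel is its own transpose.
  involutive-below : ∀ s x → x + p x < s → p (p x) ≡ x
  involutive-below (suc s) x (s≤s x+y≤s) with <-cmp (p (p x)) x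
  ... | tri≈ _ e _ = e
  ... | tri< z<x _ _ = ⊥-elim (<-irrefl (injective z x pz≡y) z<x)
    where
    z = p (p x)
    pz≡y : p z ≡ p x
    pz≡y = involutive-below s (p x) (<-≤-trans (+-monoʳ-< (p x) z<x) (≤-trans (≤-reflexive (+-comm (p x) x)) x+y≤s))
  ... | tri> _ _ x<z = ⊥-elim (minimal x<z blocked)
    where
    y = p x
    blocked : ∀ j → j < y → ¬ Hit p y x j
    blocked j j<y hit = go hit
      where
      back : p j ≤ x → p (p j) ≡ j
      back pj≤x = involutive-below s j (<-≤-trans (+-mono-<-≤ j<y pj≤x) (≤-trans (≤-reflexive (+-comm y x)) x+y≤s))
      -- (y , x) hits (j , i) exactly when (x , y) hits (i , j)
      clash : p j < x → Hit p x y (p j) → ⊥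
      clash = ¬hit x (p j)
      lt₁ : ∀ {i x j y} → j < y → x + j ≡ i + y → i < x
      lt₁ {i} {x} {j} {y} j<y e = ≤-certificate (+-mono-≤ j<y (≤-reflexive (sym e))) (solve (i ∷ x ∷ j ∷ y ∷ []))
      lt₂ : ∀ {i x j y} → j < y → x + 2 * j ≡ i + 2 * y → i < x
      lt₂ {i} {x} {j} {y} j<y e = ≤-certificate (+-mono-≤ (+-mono-≤ j<y (<⇒≤ j<y)) (≤-reflexive (sym e))) (solve (i ∷ x ∷ j ∷ y ∷ []))
      lt₃ : ∀ {i x j y} → j < y → 2 * x + j ≡ 2 * i + y → i < x
      lt₃ {i} {x} {j} {y} j<y e = *-cancelˡ-< 2 i x (≤-certificate (+-mono-≤ j<y (≤-reflexive (sym e))) (solve (i ∷ x ∷ j ∷ y ∷ [])))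
      go : Hit p y x j → ⊥
      go (inj₁ e) = <-irrefl (trans (sym (back (≤-reflexive (sym e)))) (cong p (sym e))) j<y
      go (inj₂ (inj₁ e)) = clash i<x (inj₂ (inj₁ (trans (+-comm y (p j)) (trans (sym e) (trans (+-comm x j) (cong (_+ x) (sym (back (<⇒≤ i<x)))))))))
        where i<x = lt₁ j<y e
      go (inj₂ (inj₂ (inj₁ e))) = clash i<x (inj₂ (inj₂ (inj₂ (trans (+-comm (2 * y) (p j)) (trans (sym e) (trans (+-comm x (2 * j)) (cong (λ k → 2 * k + x) (sym (back (<⇒≤ i<x)))))))))) 
        where i<x = lt₂ j<y e
      go (inj₂ (inj₂ (inj₂ e))) = clash i<x (inj₂ (inj₂ (inj₁ (trans (+-comm y (2 * p j)) (trans (sym e) (trans (+-comm (2 * x) j) (cong (_+ 2 * x) (sym (back (<⇒≤ i<x))))))))))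
        where i<x = lt₃ j<y e

  involutive : ∀ x → p (p x) ≡ x
  involutive x = involutive-below (suc (x + p x)) x ≤-refl

  -- For 2a ≤ b the differences 2a − b are not positive; m + 2k₀ < 2x excludes the finitely many other a.
  covering : ∀ {k₀} → (∀ a → a ≤ p a → k₀ ≤ a → 2 * a ≤ p a) →
    ∀ x m → x < m → m + 2 * k₀ < 2 * x → m < p x → m ≤ p m →
    ¬ (∀ a → a < x → a ≤ p a → m + a ≢ x + p a × 2 * x + a ≢ m + 2 * p a × 2 * m + a ≢ x + 2 * p a)
  covering {k₀} steep x m x<m m<2x m<px m≤pm avoid = minimal m<px clear
    where
    clear : ∀ j → j < x → ¬ Hit p x m j
    clear j j<x (inj₁ e) =
      <-irrefl refl (<-≤-trans (<-trans j<x x<m) (≤-trans m≤pm (≤-reflexive (trans (cong p e) (involutive j)))))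
    clear j j<x (inj₂ (inj₁ e)) with j ≤? p j
    ... | yes j∈A = proj₁ (avoid j j<x j∈A) (trans e (+-comm (p j) x))
    ... | no  j∉A = <-irrefl refl (<-trans x<m (arith (p j) j m x (≰⇒> j∉A) e))
      where
      arith : ∀ q j m x → q < j → m + j ≡ q + x → m < x
      arith q j m x q<j e = ≤-certificate (+-mono-≤ q<j (≤-reflexive e)) (solve (q ∷ j ∷ m ∷ x ∷ []))
    clear j j<x (inj₂ (inj₂ (inj₁ e))) with j ≤? p j
    ... | no  j∉A = proj₁ (proj₂ (avoid (p j) (<-trans (≰⇒> j∉A) j<x) (≤-trans (<⇒≤ (≰⇒> j∉A)) (≤-reflexive (sym (involutive j))))))
            (trans (+-comm (2 * x) (p j)) (trans (sym e) (cong (λ k → m + 2 * k) (sym (involutive j)))))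
    ... | yes j∈A with k₀ ≤? j
    ...   | yes k₀≤j = <-irrefl refl (<-trans m<2x (arith (p j) j m x k₀ (steep j j∈A k₀≤j) e m<2x))
      where
      arith : ∀ q j m x k → 2 * j ≤ q → m + 2 * j ≡ q + 2 * x → m + 2 * k < 2 * x → 2 * x < m + 2 * k
      arith q j m x k h e lt = ⊥-elim (<-irrefl refl (≤-certificate {suc 0} {0}
        (+-mono-≤ (+-mono-≤ h (≤-reflexive (sym e))) (+-mono-≤ lt (z≤n {2 * k})))
        (solve (q ∷ j ∷ m ∷ x ∷ k ∷ []))))
    ...   | no  k₀≰j = <-irrefl refl (<-trans m<2x (arith (p j) j m x k₀ (≰⇒> k₀≰j) e))
      where
      arith : ∀ q j m x k → j < k → m + 2 * j ≡ q + 2 * x → 2 * x < m + 2 * k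
      arith q j m x k h e = ≤-certificate
        (+-mono-≤ (+-mono-≤ h (<⇒≤ h)) (+-mono-≤ (≤-reflexive (sym e)) (z≤n {q})))
        (solve (q ∷ j ∷ m ∷ x ∷ k ∷ []))
    clear j j<x (inj₂ (inj₂ (inj₂ e))) with j ≤? p j
    ... | yes j∈A = proj₂ (proj₂ (avoid j j<x j∈A)) (trans e (+-comm (2 * p j) x))
    ... | no  j∉A with k₀ ≤? p j
    ...   | yes k₀≤a = <-irrefl refl (<-≤-trans x<m (arith (p j) j m x steep′ e))
      where
      steep′ : 2 * p j ≤ j
      steep′ = ≤-trans (steep (p j) (≤-trans (<⇒≤ (≰⇒> j∉A)) (≤-reflexive (sym (involutive j)))) k₀≤a) (≤-reflexive (involutive j))
      arith : ∀ q j m x → 2 * q ≤ j → 2 * m + j ≡ 2 * q + x → m ≤ x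
      arith q j m x h e = ≤-certificate (+-mono-≤ h (+-mono-≤ (≤-reflexive e) (z≤n {m}))) (solve (q ∷ j ∷ m ∷ x ∷ []))
    ...   | no  k₀≰a = <-irrefl refl (arith (p j) j m x k₀ (≰⇒> k₀≰a) x<m m<2x e)
      where
      arith : ∀ q j m x k → q < k → x < m → m + 2 * k < 2 * x → 2 * m + j ≡ 2 * q + x → m < m
      arith q j m x k h x<m lt e = ⊥-elim (n≮0 (≤-certificate {5} {0}
        (+-mono-≤ (+-mono-≤ (+-mono-≤ h (<⇒≤ h)) (+-mono-≤ x<m (+-mono-≤ x<m x<m)))
                  (+-mono-≤ (+-mono-≤ lt (≤-reflexive e)) (z≤n {j})))
        (solve (q ∷ j ∷ m ∷ x ∷ k ∷ []))))

-- Densities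

m<[1+m/n]*n : ∀ m n .{{_ : NonZero n}} → m < suc (m / n) * n
m<[1+m/n]*n m n = ≤-trans (s≤s (≤-reflexive (m≡m%n+[m/n]*n m n))) (+-monoˡ-≤ (m / n * n) (m%n<n m n))

module Density (p : ℕ → ℕ) (isPi : IsPi p) (Q G : ℕ) .{{Q≢0 : NonZero Q}} .{{G≢0 : NonZero G}} where

  open Kernel p isPi

  A : ℕ → Set
  A a = a ≤ p a

  A? : Decidable A
  A? a = a ≤? p a

  below? : (g : ℕ → ℕ) (t : ℕ) → Decidable (λ a → A a × g a < t)
  below? g t a = A? a ×-dec (g a <? t)

  below : ℕ → (ℕ → ℕ) → ℕ → ℕ
  below R g t = # (below? g t) R

  Upper Lower : ℕ → Set
  Upper c = ∃ λ K → ∀ n → Q * # A? n ≤ c * n + K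
  Lower c = ∃ λ K → ∀ n → c * n ≤ Q * # A? n + K

  UpperCum LowerCum : (ℕ → ℕ) → ℕ → Set
  UpperCum g φ = ∃ λ K → ∀ R t → Q * below R g t ≤ φ * t + K
  LowerCum g φ = ∃ λ K → ∀ R t → G * t ≤ R → φ * t ≤ Q * below R g t + K

  upperCum : ∀ {g lo c φ k₀} → (∀ a → A a → k₀ ≤ a → lo * a ≤ G * g a) → 1 ≤ lo →
    Upper c → G * c ≤ φ * lo → UpperCum g φ
  upperCum {g} {lo} {c} {φ} {k₀} bound 1≤lo (K , upper) rate = K′ , λ R t → begin
    Q * below R g t                ≤⟨ *-monoʳ-≤ Q (#-injection (below? g t) A? R _ (λ a → a) (into R t) (λ _ _ _ _ e → e)) ⟩
    Q * # A? (k₀ + suc (G * t / lo)) ≤⟨ upper _ ⟩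
    c * (k₀ + suc (G * t / lo)) + K  ≤⟨ arith c k₀ K (G * t / lo) (φ * t) (main t) ⟩
    φ * t + K′                     ∎
    where
    open ≤-Reasoning
    instance
      _ : NonZero lo
      _ = >-nonZero 1≤lo
    K′ = c * k₀ + c + K
    into : ∀ R t i → i < R → A i × g i < t → i < k₀ + suc (G * t / lo) × A i
    into R t i _ (i∈A , gi<t) with k₀ ≤? i
    ... | no  k₀≰i = <-≤-trans (≰⇒> k₀≰i) (m≤m+n _ _) , i∈A
    ... | yes k₀≤i = ≤-trans (*-cancelʳ-< lo i _ (begin-strict
      i * lo                    ≡⟨ *-comm i lo ⟩
      lo * i                    ≤⟨ bound i i∈A k₀≤i ⟩
      G * g i                   ≤⟨ *-monoʳ-≤ G (<⇒≤ gi<t) ⟩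
      G * t                     <⟨ m<[1+m/n]*n (G * t) lo ⟩
      suc (G * t / lo) * lo     ∎)) (m≤n+m _ k₀) , i∈A
    main : ∀ t → c * (G * t / lo) ≤ φ * t
    main t = *-cancelʳ-≤ _ _ lo (begin
      c * (G * t / lo) * lo      ≡⟨ *-assoc c _ lo ⟩
      c * (G * t / lo * lo)      ≤⟨ *-monoʳ-≤ c (m/n*n≤m (G * t) lo) ⟩
      c * (G * t)                ≡⟨ solve (c ∷ t ∷ G ∷ []) ⟩
      G * c * t                  ≤⟨ *-monoˡ-≤ t rate ⟩
      φ * lo * t                 ≡⟨ solve (φ ∷ t ∷ lo ∷ []) ⟩
      φ * t * lo                 ∎)
    arith : ∀ c k K y X → c * y ≤ X → c * (k + suc y) + K ≤ X + (c * k + c + K)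
    arith c k K y X h = ≤-certificate h (solve (c ∷ k ∷ K ∷ y ∷ X ∷ []))

  lowerCum : ∀ {g hi c φ k₀} → (∀ a → A a → k₀ ≤ a → G * g a ≤ hi * a) → 1 ≤ hi →
    Lower c → φ * hi ≤ G * c → LowerCum g φ
  lowerCum {g} {hi} {c} {φ} {k₀} bound 1≤hi (K , lower) rate = K′ , λ R t Gt≤R → let y = G * t / hi in begin
    φ * t                               ≤⟨ main t ⟩
    c * y + c                           ≤⟨ +-monoˡ-≤ c (lower y) ⟩
    Q * # A? y + K + c                  ≤⟨ +-monoˡ-≤ c (+-monoˡ-≤ K (*-monoʳ-≤ Q (count R t Gt≤R))) ⟩
    Q * (below R g t + k₀) + K + c      ≡⟨ arith Q (below R g t) k₀ K c ⟩
    Q * below R g t + K′                ∎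
    where
    open ≤-Reasoning
    instance
      _ : NonZero hi
      _ = >-nonZero 1≤hi
    K′ = Q * k₀ + K + c
    arith : ∀ q b k K c → q * (b + k) + K + c ≡ q * b + (q * k + K + c)
    arith = solve-∀
    count : ∀ R t → G * t ≤ R → # A? (G * t / hi) ≤ below R g t + k₀
    count R t Gt≤R = ≤-trans
      (#-union A? (below? g t) (_<? k₀) (G * t / hi) split)
      (+-mono-≤ (∑-monoˡ _ (≤-trans y≤Gt Gt≤R)) (#-<-≤ k₀ (G * t / hi)))
      where
      y≤Gt : G * t / hi ≤ G * t
      y≤Gt = ≤-trans (≤-trans (≤-reflexive (sym (*-identityʳ _))) (*-monoʳ-≤ (G * t / hi) 1≤hi)) (m/n*n≤m (G * t) hi)
      split : ∀ i → i < G * t / hi → A i → (A i × g i < t) ⊎ i < k₀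
      split i i<y i∈A with k₀ ≤? i
      ... | no  k₀≰i = inj₂ (≰⇒> k₀≰i)
      ... | yes k₀≤i = inj₁ (i∈A , *-cancelˡ-< G (g i) t (begin-strict
        G * g i             ≤⟨ bound i i∈A k₀≤i ⟩
        hi * i              <⟨ *-monoʳ-< hi i<y ⟩
        hi * (G * t / hi)   ≡⟨ *-comm hi _ ⟩
        G * t / hi * hi     ≤⟨ m/n*n≤m (G * t) hi ⟩
        G * t               ∎))
    main : ∀ t → φ * t ≤ c * (G * t / hi) + c
    main t = *-cancelʳ-≤ _ _ hi (begin
      φ * t * hi                     ≡⟨ solve (φ ∷ t ∷ hi ∷ []) ⟩
      φ * hi * t                     ≤⟨ *-monoˡ-≤ t rate ⟩
      G * c * t                      ≡⟨ solve (c ∷ t ∷ G ∷ []) ⟩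
      c * (G * t)                    ≤⟨ *-monoʳ-≤ c (<⇒≤ (m<[1+m/n]*n (G * t) hi)) ⟩
      c * (suc (G * t / hi) * hi)    ≡⟨ shape c (G * t / hi) hi ⟩
      (c * (G * t / hi) + c) * hi    ∎)
      where
      shape : ∀ c y h → c * (suc y * h) ≡ (c * y + c) * h
      shape = solve-∀

  B? : Decidable (λ y → p y < y)
  B? y = p y <? y

  #A+#B : ∀ n → # A? n + # B? n ≡ n
  #A+#B n = trans (sym (∑-+ n _ _)) (trans (∑-cong n one) (trans (∑-const n 1) (*-identityʳ n)))
    where
    one : ∀ i → χ (A? i) + χ (B? i) ≡ 1
    one i with A? i | B? i
    ... | yes i≤pi | yes pi<i = ⊥-elim (<⇒≱ pi<i i≤pi)
    ... | yes _    | no _     = refl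
    ... | no _     | yes _    = refl
    ... | no i≰pi  | no pi≮i  = ⊥-elim (pi≮i (≰⇒> i≰pi))

  #B≤below : ∀ n → # B? n ≤ below n p n
  #B≤below n = #-injection B? (below? p n) n n p
    (λ y y<n py<y → <-trans py<y y<n ,
      ≤-trans (<⇒≤ py<y) (≤-reflexive (sym (involutive y))) , subst (_< n) (sym (involutive y)) y<n)
    (λ i j _ _ e → injective i j e)

  below≤#B+1 : ∀ R n → below R p n ≤ # B? n + 1
  below≤#B+1 R n = begin
    below R p n                           ≤⟨ #-injection (below? p n) (λ y → p y ≤? y) R n p
                                               (λ { a _ (a∈A , pa<n) → pa<n , ≤-trans (≤-reflexive (involutive a)) a∈A })
                                               (λ i j _ _ e → injective i j e) ⟩
    # (λ y → p y ≤? y) n                  ≤⟨ #-union (λ y → p y ≤? y) B? (λ y → p y ≟ y) n (λ _ _ → m≤n⇒m<n∨m≡n) ⟩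
    # B? n + # (λ y → p y ≟ y) n          ≤⟨ +-monoʳ-≤ (# B? n) (#-unique (λ y → p y ≟ y) n fixed) ⟩
    # B? n + 1                            ∎
    where
    open ≤-Reasoning
    fixed : ∀ i j → p i ≡ i → p j ≡ j → i ≡ j
    fixed i j e e′ = injective₁ i j (trans (cong₂ _+_ e (sym e′)) (+-comm i (p j)))

  lower-of-cum : ∀ {φ} → UpperCum p φ → Lower (Q ∸ φ)
  lower-of-cum {φ} (K , upper) = K , λ n → begin
    (Q ∸ φ) * n                ≡⟨ *-distribʳ-∸ n Q φ ⟩
    Q * n ∸ φ * n              ≤⟨ m≤n+o⇒m∸n≤o (Q * n) (φ * n) (total n) ⟩
    Q * # A? n + K             ∎
    where
    open ≤-Reasoning
    total : ∀ n → Q * n ≤ φ * n + (Q * # A? n + K)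
    total n = begin
      Q * n                              ≡⟨ cong (Q *_) (sym (#A+#B n)) ⟩
      Q * (# A? n + # B? n)              ≡⟨ *-distribˡ-+ Q (# A? n) _ ⟩
      Q * # A? n + Q * # B? n            ≤⟨ +-monoʳ-≤ (Q * # A? n) (≤-trans (*-monoʳ-≤ Q (#B≤below n)) (upper n n)) ⟩
      Q * # A? n + (φ * n + K)           ≡⟨ shape (Q * # A? n) (φ * n) K ⟩
      φ * n + (Q * # A? n + K)           ∎
      where
      shape : ∀ x y z → x + (y + z) ≡ y + (x + z)
      shape = solve-∀

  upper-of-cum : ∀ {φ} → LowerCum p φ → Upper (Q ∸ φ)
  upper-of-cum {φ} (K , lower) = Q + K , λ n → begin
    Q * # A? n                          ≤⟨ m+n≤o⇒m≤o∸n (Q * # A? n) (total n) ⟩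
    Q * n + (Q + K) ∸ φ * n             ≤⟨ m≤n+o⇒m∸n≤o (Q * n + (Q + K)) (φ * n) (begin
        Q * n + (Q + K)                          ≤⟨ +-monoˡ-≤ (Q + K) (m≤n+m∸n (Q * n) (φ * n)) ⟩
        φ * n + (Q * n ∸ φ * n) + (Q + K)        ≡⟨ +-assoc (φ * n) _ _ ⟩
        φ * n + ((Q * n ∸ φ * n) + (Q + K))      ∎) ⟩
    Q * n ∸ φ * n + (Q + K)             ≡⟨ cong (_+ (Q + K)) (sym (*-distribʳ-∸ n Q φ)) ⟩
    (Q ∸ φ) * n + (Q + K)               ∎
    where
    open ≤-Reasoning
    total : ∀ n → Q * # A? n + φ * n ≤ Q * n + (Q + K)
    total n = begin
      Q * # A? n + φ * n                            ≤⟨ +-monoʳ-≤ (Q * # A? n) (lower (G * n) n ≤-refl) ⟩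
      Q * # A? n + (Q * below (G * n) p n + K)      ≤⟨ +-monoʳ-≤ (Q * # A? n) (+-monoˡ-≤ K (*-monoʳ-≤ Q (below≤#B+1 (G * n) n))) ⟩
      Q * # A? n + (Q * (# B? n + 1) + K)           ≡⟨ shape (# A? n) (# B? n) ⟩
      Q * (# A? n + # B? n) + (Q + K)               ≡⟨ cong (λ k → Q * k + (Q + K)) (#A+#B n) ⟩
      Q * n + (Q + K)                               ∎
      where
      shape : ∀ a b → Q * a + (Q * (b + 1) + K) ≡ Q * (a + b) + (Q + K)
      shape a b = solve (a ∷ b ∷ Q ∷ K ∷ [])

  upper-trivial : Upper Q
  upper-trivial = 0 , λ n → ≤-trans (*-monoʳ-≤ Q (#≤n A? n)) (m≤m+n _ _)

  lower-half : ∀ {c} → 2 * c ≤ Q → Lower c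
  lower-half {c} 2c≤Q = 0 , λ n → begin
    c * n                        ≡⟨ cong (c *_) (sym (#A+#B n)) ⟩
    c * (# A? n + # B? n)        ≤⟨ *-monoʳ-≤ c (+-monoʳ-≤ (# A? n) (B≤A n)) ⟩
    c * (# A? n + # A? n)        ≡⟨ shape c (# A? n) ⟩
    2 * c * # A? n               ≤⟨ *-monoˡ-≤ (# A? n) 2c≤Q ⟩
    Q * # A? n                   ≡⟨ sym (+-identityʳ _) ⟩
    Q * # A? n + 0               ∎
    where
    open ≤-Reasoning
    shape : ∀ c a → c * (a + a) ≡ 2 * c * a
    shape = solve-∀
    B≤A : ∀ n → # B? n ≤ # A? n
    B≤A n = #-injection B? A? n n p
      (λ y y<n py<y → <-trans py<y y<n , ≤-trans (<⇒≤ py<y) (≤-reflexive (sym (involutive y))))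
      (λ i j _ _ e → injective i j e)

  lower-⊔′ : ∀ {c d} → Lower c → Lower d → Lower (c ⊔′ d)
  lower-⊔′ {c} {d} h h′ with c <ᵇ d
  ... | true  = h′
  ... | false = h

  crowding : ∀ {c z k₀} (f : ℕ → ℕ → ℕ) →
    (∀ n a → a < G * n → A a → k₀ ≤ a → f n a ≤ z * n) →
    (∀ n i j → i < G * n → A i → k₀ ≤ i → j < G * n → A j → k₀ ≤ j → f n i ≡ f n j → i ≡ j) →
    Lower c → ¬ (Q * z < G * c)
  crowding {c} {z} {k₀} f into inj (K , lower) Qz<Gc =
    n≮0 (≤-certificate {1} {0} (+-mono-≤ (*-monoˡ-≤ n Qz<Gc) (bound n)) (shape z c G Q K k₀))
    where
    open ≤-Reasoning
    n = suc (Q * suc k₀ + K)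
    far? : ∀ n → Decidable (λ a → a < G * n × A a × k₀ ≤ a)
    far? n a = a <? G * n ×-dec (A? a ×-dec (k₀ ≤? a))
    count : ∀ n → # A? (G * n) ≤ suc (z * n) + k₀
    count n = ≤-trans
      (#-union A? (far? n) (_<? k₀) (G * n) split)
      (+-mono-≤ (#-pigeonhole (far? n) (G * n) (suc (z * n)) (f n) (λ { a a<Gn (_ , a∈A , k₀≤a) → s≤s (into n a a<Gn a∈A k₀≤a) })
                  (λ { i j (i< , i∈A , k₀≤i) (j< , j∈A , k₀≤j) → inj n i j i< i∈A k₀≤i j< j∈A k₀≤j }))
                (#-<-≤ k₀ (G * n)))
      where
      split : ∀ a → a < G * n → A a → (a < G * n × A a × k₀ ≤ a) ⊎ a < k₀
      split a a<Gn a∈A with k₀ ≤? a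
      ... | yes k₀≤a = inj₁ (a<Gn , a∈A , k₀≤a)
      ... | no  k₀≰a = inj₂ (≰⇒> k₀≰a)
    bound : ∀ n → c * (G * n) ≤ Q * (suc (z * n) + k₀) + K
    bound n = ≤-trans (lower (G * n)) (+-monoˡ-≤ K (*-monoʳ-≤ Q (count n)))
    shape : ∀ z c g q K k → let n = suc (q * suc k + K) in
      1 + (g * c * n + (q * (suc (z * n) + k) + K)) ≡ 0 + (suc (q * z) * n + c * (g * n))
    shape = solve-∀

-- The double count in a box

increment-upper : ∀ Q f w φ⁺ φ⁻ δ σ s M {K K′} →
  Q * (f + w) ≤ φ⁺ * (s + M) + K → φ⁻ * s ≤ Q * f + K′ → φ⁺ ≤ φ⁻ + δ → s ≤ σ * M →
  Q * w ≤ (φ⁺ + σ * δ) * M + (K + K′)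
increment-upper Q f w φ⁺ φ⁻ δ σ s M {K} {K′} h₁ h₂ h₃ h₄ = ≤-certificate
  (+-mono-≤ (+-mono-≤ h₁ h₂) (+-mono-≤ (scaleʳ s h₃) (scaleˡ δ h₄)))
  (solve (Q ∷ f ∷ w ∷ φ⁺ ∷ φ⁻ ∷ δ ∷ σ ∷ s ∷ M ∷ K ∷ K′ ∷ []))

increment-lower : ∀ Q f w φ⁺ φ⁻ δ σ s M {K K′} →
  φ⁻ * (s + M) ≤ Q * (f + w) + K → Q * f ≤ φ⁺ * s + K′ → φ⁺ ≤ φ⁻ + δ → s ≤ σ * M →
  (φ⁻ ∸ σ * δ) * M ≤ Q * w + (K + K′)
increment-lower Q f w φ⁺ φ⁻ δ σ s M {K} {K′} h₁ h₂ h₃ h₄ =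
  ≤-trans (≤-reflexive (*-distribʳ-∸ M φ⁻ (σ * δ))) (m≤n+o⇒m∸n≤o (φ⁻ * M) (σ * δ * M)
    (≤-certificate
      (+-mono-≤ (+-mono-≤ h₁ h₂) (+-mono-≤ (scaleʳ s h₃) (scaleˡ δ h₄)))
      (solve (Q ∷ f ∷ w ∷ φ⁺ ∷ φ⁻ ∷ δ ∷ σ ∷ s ∷ M ∷ K ∷ K′ ∷ []))))

∑-weighted-≤ : ∀ Q M (w f : ℕ → ℕ) {e} → (∀ k → k < M → Q * f k ≤ e) → Q * ∑ M (λ k → w k * f k) ≤ ∑ M w * e
∑-weighted-≤ Q M w f {e} h = begin
  Q * ∑ M (λ k → w k * f k)      ≡⟨ sym (∑-*ˡ M Q _) ⟩
  ∑ M (λ k → Q * (w k * f k))    ≤⟨ ∑-mono M (λ k k<M → ≤-trans (≤-reflexive (shape Q (w k) (f k))) (*-monoʳ-≤ (w k) (h k k<M))) ⟩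
  ∑ M (λ k → w k * e)            ≡⟨ ∑-*ʳ M w e ⟩
  ∑ M w * e                      ∎
  where
  open ≤-Reasoning
  shape : ∀ q w f → q * (w * f) ≡ w * (q * f)
  shape = solve-∀

∑-weighted-≥ : ∀ Q M (w f : ℕ → ℕ) {e K} → (∀ k → k < M → e ≤ Q * f k + K) →
  ∑ M w * e ≤ Q * ∑ M (λ k → w k * f k) + ∑ M w * K
∑-weighted-≥ Q M w f {e} {K} h = begin
  ∑ M w * e                                            ≡⟨ sym (∑-*ʳ M w e) ⟩
  ∑ M (λ k → w k * e)                                  ≤⟨ ∑-mono M (λ k k<M → ≤-trans (*-monoʳ-≤ (w k) (h k k<M)) (≤-reflexive (shape Q (w k) (f k) K))) ⟩
  ∑ M (λ k → Q * (w k * f k) + w k * K)                ≡⟨ ∑-+ M _ _ ⟩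
  ∑ M (λ k → Q * (w k * f k)) + ∑ M (λ k → w k * K)    ≡⟨ cong₂ _+_ (∑-*ˡ M Q _) (∑-*ʳ M w K) ⟩
  Q * ∑ M (λ k → w k * f k) + ∑ M w * K                ∎
  where
  open ≤-Reasoning
  shape : ∀ q w f K → w * (q * f + K) ≡ q * (w * f) + w * K
  shape = solve-∀

∑∑-product : ∀ M f g → ∑ M (λ i → ∑ M (λ k → f i * g k)) ≡ ∑ M f * ∑ M g
∑∑-product M f g = trans (∑-cong M (λ i → ∑-*ˡ M (f i) g)) (∑-*ʳ M f (∑ M g))

box-sum : ∀ Q M (α β α′ β′ : ℕ → ℕ) (D U T : ℕ → ℕ → ℕ) {e⁺ e⁻ eᵤ eₜ K} →
  (∀ i k → i < M → k < M →
    α i * α′ k + β′ k * D i k ≤ α i * (D i k + U i k) + β i * β′ k + α′ k * T i k) →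
  (∀ i → i < M → Q * ∑ M (D i) ≤ e⁺) → (∀ k → k < M → e⁻ ≤ Q * ∑ M (λ i → D i k) + K) →
  (∀ i → i < M → Q * ∑ M (U i) ≤ eᵤ) → (∀ k → k < M → Q * ∑ M (λ i → T i k) ≤ eₜ) →
  Q * (∑ M α * ∑ M α′) + ∑ M β′ * e⁻ ≤
    ∑ M α * (e⁺ + eᵤ) + Q * (∑ M β * ∑ M β′) + ∑ M α′ * eₜ + ∑ M β′ * K
box-sum Q M α β α′ β′ D U T {e⁺} {e⁻} {eᵤ} {eₜ} {K} pointwise D≤ D≥ U≤ T≤ =
  arith Q (*-monoʳ-≤ Q total) (∑-weighted-≥ Q M β′ (λ k → ∑ M (λ i → D i k)) D≥)
    (∑-weighted-≤ Q M α (λ i → ∑ M (D i) + ∑ M (U i)) DU≤) (∑-weighted-≤ Q M α′ (λ k → ∑ M (λ i → T i k)) T≤)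
  where
  open ≤-Reasoning
  DU≤ : ∀ i → i < M → Q * (∑ M (D i) + ∑ M (U i)) ≤ e⁺ + eᵤ
  DU≤ i i<M = ≤-trans (≤-reflexive (*-distribˡ-+ Q (∑ M (D i)) (∑ M (U i)))) (+-mono-≤ (D≤ i i<M) (U≤ i i<M))
  column : ∀ (w : ℕ → ℕ) (F : ℕ → ℕ → ℕ) →
    ∑ M (λ i → ∑ M (λ k → w k * F i k)) ≡ ∑ M (λ k → w k * ∑ M (λ i → F i k))
  column w F = trans (∑-swap M M (λ i k → w k * F i k)) (∑-cong M λ k → ∑-*ˡ M (w k) _)
  total : ∑ M α * ∑ M α′ + ∑ M (λ k → β′ k * ∑ M (λ i → D i k)) ≤
    ∑ M (λ i → α i * (∑ M (D i) + ∑ M (U i))) + ∑ M β * ∑ M β′ + ∑ M (λ k → α′ k * ∑ M (λ i → T i k))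
  total = begin
    ∑ M α * ∑ M α′ + ∑ M (λ k → β′ k * ∑ M (λ i → D i k))
      ≡⟨ cong₂ _+_ (sym (∑∑-product M α α′)) (sym (column β′ D)) ⟩
    ∑ M (λ i → ∑ M (λ k → α i * α′ k)) + ∑ M (λ i → ∑ M (λ k → β′ k * D i k))
      ≡⟨ sym (trans (∑-cong M λ i → ∑-+ M _ _) (∑-+ M _ _)) ⟩
    ∑ M (λ i → ∑ M (λ k → α i * α′ k + β′ k * D i k))
      ≤⟨ ∑-mono M (λ i i<M → ∑-mono M (λ k k<M → pointwise i k i<M k<M)) ⟩
    ∑ M (λ i → ∑ M (λ k → α i * (D i k + U i k) + β i * β′ k + α′ k * T i k))
      ≡⟨ trans (∑-cong M λ i → trans (∑-+ M _ _) (cong (_+ _) (∑-+ M _ _))) (trans (∑-+ M _ _) (cong (_+ _) (∑-+ M _ _))) ⟩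
    ∑ M (λ i → ∑ M (λ k → α i * (D i k + U i k))) + ∑ M (λ i → ∑ M (λ k → β i * β′ k)) + ∑ M (λ i → ∑ M (λ k → α′ k * T i k))
      ≡⟨ cong₂ _+_ (cong₂ _+_ (∑-cong M λ i → trans (∑-*ˡ M (α i) _) (cong (α i *_) (∑-+ M (D i) (U i)))) (∑∑-product M β β′)) (column α′ T) ⟩
    ∑ M (λ i → α i * (∑ M (D i) + ∑ M (U i))) + ∑ M β * ∑ M β′ + ∑ M (λ k → α′ k * ∑ M (λ i → T i k)) ∎
  arith : ∀ Q {x y z w b L P R S} → Q * (x + y) ≤ Q * (z + b + w) → L ≤ Q * y + P → Q * z ≤ R → Q * w ≤ S →
    Q * x + L ≤ R + Q * b + S + P
  arith Q {x} {y} {z} {w} {b} {L} {P} {R} {S} h₁ h₂ h₃ h₄ = ≤-certificate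
    (+-mono-≤ (+-mono-≤ h₁ h₂) (+-mono-≤ h₃ h₄)) (solve (Q ∷ x ∷ y ∷ z ∷ w ∷ b ∷ L ∷ P ∷ R ∷ S ∷ []))

box-bound : ∀ {Q M a b a′ b′ e⁺ e⁻ eᵤ eₜ s s′ c c′ K} .{{_ : NonZero M}} →
  a + b ≡ M → a′ + b′ ≡ M → s + e⁺ + eᵤ ≡ Q → s′ + e⁻ + eₜ ≡ Q →
  Q * (a * a′) + b′ * (e⁻ * M) ≤
    a * ((e⁺ * M + K) + (eᵤ * M + K)) + Q * (b * b′) + a′ * (eₜ * M + K) + b′ * K →
  c * M ≤ Q * a + K → c′ * M ≤ Q * a′ + K →
  Q * Q < s * c + s′ * c′ + Q * e⁻ →
  M ≤ 3 * Q * K + s * K + s′ * K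
box-bound {Q} {M} {a} {b} {a′} {b′} {e⁺} {e⁻} {eᵤ} {eₜ} {s} {s′} {c} {c′} {K} a+b a′+b′ es es′ h hc hc′ test =
  ≤-certificate (+-mono-≤ (+-mono-≤ (scaleʳ M test) (scaleˡ Q reduced)) (+-mono-≤ (scaleˡ s hc) (scaleˡ s′ hc′)))
    (solve (Q ∷ M ∷ a ∷ a′ ∷ e⁻ ∷ s ∷ s′ ∷ c ∷ c′ ∷ K ∷ []))
  where
  complement : Q * (b * b′ + M * (a + a′)) ≡ Q * (M * M + a * a′)
  complement = cong (Q *_) (begin
    b * b′ + M * (a + a′)                           ≡⟨ cong (b * b′ +_) (*-distribˡ-+ M a a′) ⟩
    b * b′ + (M * a + M * a′)                       ≡⟨ cong (b * b′ +_) (cong₂ _+_ (cong (_* a) (sym a′+b′)) (cong (_* a′) (sym a+b))) ⟩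
    b * b′ + ((a′ + b′) * a + (a + b) * a′)         ≡⟨ solve (a ∷ b ∷ a′ ∷ b′ ∷ []) ⟩
    (a + b) * (a′ + b′) + a * a′                    ≡⟨ cong (_+ a * a′) (cong₂ _*_ a+b a′+b′) ⟩
    M * M + a * a′                                  ∎)
    where open ≡-Reasoning
  constants : K * (2 * a + (a′ + b′)) ≤ K * (3 * M)
  constants = *-monoʳ-≤ K (≤-trans (+-mono-≤ (*-monoʳ-≤ 2 (≤-trans (m≤m+n a b) (≤-reflexive a+b))) (≤-reflexive a′+b′))
    (≤-reflexive (shape M)))
    where
    shape : ∀ m → 2 * m + m ≡ 3 * m
    shape = solve-∀
  reduced : s * a + s′ * a′ + e⁻ * M ≤ Q * M + 3 * K
  reduced = *-cancelˡ-≤ M (≤-certificate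
    (+-mono-≤ (+-mono-≤ (+-mono-≤ h (≤-reflexive complement))
                        (+-mono-≤ (≤-reflexive (cong (λ q → q * M * a) es)) (≤-reflexive (cong (λ q → q * M * a′) es′))))
              (+-mono-≤ (≤-reflexive (cong (λ q → q * e⁻ * M) (sym a′+b′))) constants))
    (solve (Q ∷ M ∷ a ∷ b ∷ a′ ∷ b′ ∷ e⁺ ∷ e⁻ ∷ eᵤ ∷ eₜ ∷ s ∷ s′ ∷ K ∷ [])))

module Windows (p : ℕ → ℕ) (isPi : IsPi p) (Q G : ℕ) .{{Q≢0 : NonZero Q}} .{{G≢0 : NonZero G}} where

  open Kernel p isPi
  open Density p isPi Q G

  window? : (g : ℕ → ℕ) (s M : ℕ) → Decidable (λ a → A a × s ≤ g a × g a < s + M)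
  window? g s M a = A? a ×-dec (s ≤? g a) ×-dec (g a <? s + M)

  below-+ : ∀ R g s M → below R g (s + M) ≡ below R g s + # (window? g s M) R
  below-+ R g s M = trans (∑-cong R split) (∑-+ R _ _)
    where
    split : ∀ a → χ (below? g (s + M) a) ≡ χ (below? g s a) + χ (window? g s M a)
    split a = by-cases (below? g (s + M) a) (below? g s a) (window? g s M a)
      where
      by-cases : (x : Dec (A a × g a < s + M)) (y : Dec (A a × g a < s)) (z : Dec (A a × s ≤ g a × g a < s + M)) →
        χ x ≡ χ y + χ z
      by-cases (yes _) (yes (_ , l)) (yes (_ , r , _)) = ⊥-elim (<⇒≱ l r)
      by-cases (yes _) (yes _) (no _)  = refl
      by-cases (yes _) (no _)  (yes _) = refl
      by-cases (yes (a∈A , u)) (no ¬l) (no ¬w) = ⊥-elim (¬w (a∈A , ≮⇒≥ (λ l → ¬l (a∈A , l)) , u))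
      by-cases (no ¬u) (yes (a∈A , l)) _ = ⊥-elim (¬u (a∈A , <-≤-trans l (m≤m+n s M)))
      by-cases (no ¬u) (no _) (yes (a∈A , _ , u)) = ⊥-elim (¬u (a∈A , u))
      by-cases (no _)  (no _) (no _) = refl

  WindowUpper WindowLower : (ℕ → ℕ) → ℕ → ℕ → Set
  WindowUpper g σ e = ∃ λ K → ∀ R s M → s ≤ σ * M → G * s ≤ R → Q * # (window? g s M) R ≤ e * M + K
  WindowLower g σ e = ∃ λ K → ∀ R s M → s ≤ σ * M → G * (s + M) ≤ R → e * M ≤ Q * # (window? g s M) R + K

  windowUpper : ∀ {g φ⁻ φ⁺} σ → LowerCum g φ⁻ → UpperCum g φ⁺ → WindowUpper g σ (φ⁺ + σ * (φ⁺ ∸ φ⁻))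
  windowUpper {g} {φ⁻} {φ⁺} σ (K′ , lower) (K , upper) = K + K′ , λ R s M s≤σM Gs≤R →
    increment-upper Q (below R g s) (# (window? g s M) R) φ⁺ φ⁻ (φ⁺ ∸ φ⁻) σ s M
      (≤-trans (≤-reflexive (cong (Q *_) (sym (below-+ R g s M)))) (upper R (s + M)))
      (lower R s Gs≤R) (m≤n+m∸n φ⁺ φ⁻) s≤σM

  windowLower : ∀ {g φ⁻ φ⁺} σ → LowerCum g φ⁻ → UpperCum g φ⁺ → WindowLower g σ (φ⁻ ∸ σ * (φ⁺ ∸ φ⁻))
  windowLower {g} {φ⁻} {φ⁺} σ (K′ , lower) (K , upper) = K′ + K , λ R s M s≤σM Gs≤R →
    increment-lower Q (below R g s) (# (window? g s M) R) φ⁺ φ⁻ (φ⁺ ∸ φ⁻) σ s M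
      (≤-trans (lower R (s + M) Gs≤R) (≤-reflexive (cong (λ k → Q * k + K′) (below-+ R g s M))))
      (upper R s) (m≤n+m∸n φ⁺ φ⁻) s≤σM

  SegmentLower : ℕ → ℕ → Set
  SegmentLower σ e = ∃ λ K → ∀ M → e * M ≤ Q * ∑ M (λ i → χ (A? (σ * M + i))) + K

  segmentLower : ∀ {c⁻ c⁺} σ → Lower c⁻ → Upper c⁺ → SegmentLower σ (c⁻ ∸ σ * (c⁺ ∸ c⁻))
  segmentLower {c⁻} {c⁺} σ (K′ , lower) (K , upper) = K′ + K , λ M →
    increment-lower Q (# A? (σ * M)) (∑ M (λ i → χ (A? (σ * M + i)))) c⁺ c⁻ (c⁺ ∸ c⁻) σ (σ * M) M
      (≤-trans (lower (σ * M + M)) (≤-reflexive (cong (λ k → Q * k + K′) (∑-split (σ * M) M _))))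
      (upper (σ * M)) (m≤n+m∸n c⁺ c⁻) ≤-refl

  diagonal knight : ℕ → ℕ
  diagonal a = p a ∸ a
  knight   a = 2 * p a ∸ a

  diagonal-eq : ∀ {a} → A a → a + diagonal a ≡ p a
  diagonal-eq = m+[n∸m]≡n

  knight-eq : ∀ {a} → A a → a + knight a ≡ 2 * p a
  knight-eq {a} a∈A = m+[n∸m]≡n (≤-trans a∈A (m≤m+n _ _))

  module Box (k₀ : ℕ) (steep : ∀ a → A a → k₀ ≤ a → 2 * a ≤ p a) (M : ℕ) (2k₀<M : 2 * k₀ < M) where

    -- For x = 4M + i and y = 6M + k with i, k < M we have x < y < 2x, with margins of order M.
    R : ℕ
    R = G * (10 * M)

    x y : ℕ → ℕ
    x i = 4 * M + i
    y k = 6 * M + k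

    D? : ∀ i k → Decidable (λ a → A a × y k + a ≡ x i + p a)
    D? i k a = A? a ×-dec (y k + a ≟ x i + p a)

    U? : ∀ i k → Decidable (λ a → A a × 2 * x i + a ≡ y k + 2 * p a)
    U? i k a = A? a ×-dec (2 * x i + a ≟ y k + 2 * p a)

    T? : ∀ i k → Decidable (λ a → A a × 2 * y k + a ≡ x i + 2 * p a)
    T? i k a = A? a ×-dec (2 * y k + a ≟ x i + 2 * p a)

    #D #U #T : ℕ → ℕ → ℕ
    #D i k = # (D? i k) R
    #U i k = # (U? i k) R
    #T i k = # (T? i k) R

    D≤1 : ∀ i k → #D i k ≤ 1
    D≤1 i k = #-unique (D? i k) R λ { a b (_ , e) (_ , e′) → injective₁ a b (arith (x i) (y k) a b (p a) (p b) e e′) }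
      where
      arith : ∀ x y a b q r → y + a ≡ x + q → y + b ≡ x + r → q + b ≡ r + a
      arith x y a b q r e e′ = +-cancelˡ-≡ (x + y) _ _ (begin
        x + y + (q + b)        ≡⟨ solve (x ∷ y ∷ a ∷ b ∷ q ∷ r ∷ []) ⟩
        (x + q) + (y + b)      ≡⟨ cong₂ _+_ (sym e) e′ ⟩
        (y + a) + (x + r)      ≡⟨ solve (x ∷ y ∷ a ∷ b ∷ q ∷ r ∷ []) ⟩
        x + y + (r + a)        ∎)
        where open ≡-Reasoning

    covered : ∀ i k → i < M → k < M → A (x i) → A (y k) → 1 ≤ #D i k + #U i k + #T i k
    covered i k i<M k<M x∈A y∈A with #D i k + #U i k + #T i k in eq
    ... | suc _ = s≤s z≤n
    ... | zero  = ⊥-elim (covering steep (x i) (y k) x<y y<2x (<-≤-trans (≤-<-trans (m≤m+n _ _) y<2x) (steep (x i) x∈A k₀≤x)) y∈A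
      λ a a<x a∈A → let a<R = <-≤-trans a<x x≤R in
        (λ e → absent (≤-trans (#-witness (D? i k) a<R (a∈A , e)) (≤-trans (m≤m+n _ _) (m≤m+n _ _)))) ,
        (λ e → absent (≤-trans (#-witness (U? i k) a<R (a∈A , e)) (≤-trans (m≤n+m _ (#D i k)) (m≤m+n _ _)))) ,
        (λ e → absent (≤-trans (#-witness (T? i k) a<R (a∈A , e)) (m≤n+m _ _))))
      where
      absent : ¬ (1 ≤ #D i k + #U i k + #T i k)
      absent h = n≮0 (subst (1 ≤_) eq h)
      x<y : x i < y k
      x<y = ≤-certificate {suc (4 * M + i)} {6 * M + k} (+-mono-≤ i<M (z≤n {M + k})) (solve (M ∷ i ∷ k ∷ []))
      y<2x : y k + 2 * k₀ < 2 * x i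
      y<2x = arith k k<M 2k₀<M
        where
        arith : ∀ k → k < M → 2 * k₀ < M → 6 * M + k + 2 * k₀ < 2 * (4 * M + i)
        arith k h h′ = ≤-certificate (+-mono-≤ (+-mono-≤ (<⇒≤ h) h′) (z≤n {2 * i})) (solve (M ∷ i ∷ k ∷ k₀ ∷ []))
      k₀≤x : k₀ ≤ x i
      k₀≤x = ≤-certificate {k₀} {4 * M + i} (+-mono-≤ (<⇒≤ 2k₀<M) (z≤n {k₀ + 3 * M + i})) (solve (M ∷ i ∷ k₀ ∷ []))
      x≤R : x i ≤ R
      x≤R = ≤-trans (≤-certificate {4 * M + i} {10 * M} (+-mono-≤ (<⇒≤ i<M) (z≤n {5 * M})) (solve (M ∷ i ∷ []))) (m≤n*m (10 * M) G)

    α α′ β β′ : ℕ → ℕ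
    α  i = χ (A? (x i))
    α′ k = χ (A? (y k))
    β  i = χ (B? (x i))
    β′ k = χ (B? (y k))

    pointwise : ∀ i k → i < M → k < M →
      α i * α′ k + β′ k * #D i k ≤ α i * (#D i k + #U i k) + β i * β′ k + α′ k * #T i k
    pointwise i k i<M k<M with #D i k | #U i k | #T i k | D≤1 i k | covered i k i<M k<M
    ... | d | u | t | d≤1 | cov with A? (x i) | B? (x i) | A? (y k) | B? (y k)
    ... | yes le | yes lt | _ | _ = ⊥-elim (<⇒≱ lt le)
    ... | no ¬le | no ¬lt | _ | _ = ⊥-elim (¬lt (≰⇒> ¬le))
    ... | _ | _ | yes le | yes lt = ⊥-elim (<⇒≱ lt le)
    ... | _ | _ | no ¬le | no ¬lt = ⊥-elim (¬lt (≰⇒> ¬le))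
    ... | yes x∈A | no _ | yes y∈A | no _ = ≤-trans (cov x∈A y∈A) (≤-reflexive (solve (d ∷ u ∷ t ∷ [])))
    ... | yes _ | no _ | no _ | yes _ = ≤-certificate (z≤n {u}) (solve (d ∷ u ∷ t ∷ []))
    ... | no _ | yes _ | yes _ | no _ = z≤n
    ... | no _ | yes _ | no _ | yes _ = ≤-certificate d≤1 (solve (d ∷ u ∷ t ∷ []))

    total : ∀ σ → ∑ M (λ i → χ (A? (σ * M + i))) + ∑ M (λ i → χ (B? (σ * M + i))) ≡ M
    total σ = +-cancelˡ-≡ (# A? (σ * M) + # B? (σ * M)) _ _ (begin
      # A? (σ * M) + # B? (σ * M) + (∑ M (λ i → χ (A? (σ * M + i))) + ∑ M (λ i → χ (B? (σ * M + i))))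
        ≡⟨ shape (# A? (σ * M)) (# B? (σ * M)) _ _ ⟩
      # A? (σ * M) + ∑ M (λ i → χ (A? (σ * M + i))) + (# B? (σ * M) + ∑ M (λ i → χ (B? (σ * M + i))))
        ≡⟨ cong₂ _+_ (sym (∑-split (σ * M) M _)) (sym (∑-split (σ * M) M _)) ⟩
      # A? (σ * M + M) + # B? (σ * M + M)      ≡⟨ #A+#B (σ * M + M) ⟩
      σ * M + M                                ≡⟨ cong (_+ M) (sym (#A+#B (σ * M))) ⟩
      # A? (σ * M) + # B? (σ * M) + M          ∎)
      where
      open ≡-Reasoning
      shape : ∀ a b c d → a + b + (c + d) ≡ a + c + (b + d)
      shape = solve-∀

    D-row : ∀ i → i < M → ∑ M (#D i) ≤ # (window? diagonal (2 * M ∸ i) M) R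
    D-row i i<M = ≤-trans (≤-reflexive (∑-swap M R λ k a → χ (D? i k a)))
      (∑-mono R λ a _ → #-unique-≤χ (λ k → D? i k a) (window? diagonal (2 * M ∸ i) M a) M
        (λ { k l (_ , e) (_ , e′) → +-cancelˡ-≡ (6 * M) k l (+-cancelʳ-≡ a _ _ (trans e (sym e′))) })
        (λ { k k<M (a∈A , e) → a∈A , in-window k a k<M (trans e (cong (x i +_) (sym (diagonal-eq a∈A)))) }))
      where
      i≤2M : i ≤ 2 * M
      i≤2M = ≤-trans (<⇒≤ i<M) (m≤m+n M _)
      in-window : ∀ k a {e} → k < M → 6 * M + k + a ≡ 4 * M + i + (a + e) → 2 * M ∸ i ≤ e × e < 2 * M ∸ i + M
      in-window k a {e} k<M eq with 2 * M ∸ i | m+[n∸m]≡n i≤2M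
      ... | s | is = ≤-certificate (+-mono-≤ (≤-reflexive is) (+-mono-≤ (≤-reflexive eq) (z≤n {k}))) (solve (M ∷ i ∷ k ∷ a ∷ e ∷ s ∷ [])) ,
        ≤-certificate (+-mono-≤ (≤-reflexive (sym is)) (+-mono-≤ (≤-reflexive (sym eq)) k<M)) (solve (M ∷ i ∷ k ∷ a ∷ e ∷ s ∷ []))

    D-column : ∀ k → k < M → # (window? diagonal (suc (M + k)) M) R ≤ ∑ M (λ i → #D i k)
    D-column k k<M = ≤-trans
      (∑-mono R λ a _ → χ-≤# (λ i → D? i k a) (window? diagonal (suc (M + k)) M a) M
        (λ { (a∈A , s≤e , e<s+M) → hit a∈A s≤e e<s+M }))
      (≤-reflexive (sym (∑-swap M R λ i a → χ (D? i k a))))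
      where
      hit : ∀ {a} → A a → suc (M + k) ≤ diagonal a → diagonal a < suc (M + k) + M →
        ∃ λ i → i < M × A a × y k + a ≡ x i + p a
      hit {a} a∈A s≤e e<s+M = 2 * M + k ∸ diagonal a , proj₁ both , a∈A , trans (proj₂ both) (cong (x (2 * M + k ∸ diagonal a) +_) (diagonal-eq a∈A))
        where
        e≤2M+k : diagonal a ≤ 2 * M + k
        e≤2M+k = arith (diagonal a) e<s+M
          where
          arith : ∀ e → e < suc (M + k) + M → e ≤ 2 * M + k
          arith e h = ≤-certificate h (solve (M ∷ k ∷ e ∷ []))
        both : 2 * M + k ∸ diagonal a < M × y k + a ≡ x (2 * M + k ∸ diagonal a) + (a + diagonal a)
        both = arith (diagonal a) (2 * M + k ∸ diagonal a) s≤e (m+[n∸m]≡n e≤2M+k)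
          where
          arith : ∀ e i → suc (M + k) ≤ e → e + i ≡ 2 * M + k → i < M × 6 * M + k + a ≡ 4 * M + i + (a + e)
          arith e i h eq = ≤-certificate (+-mono-≤ h (≤-reflexive eq)) (solve (M ∷ k ∷ e ∷ i ∷ [])) , (begin
            6 * M + k + a              ≡⟨ solve (M ∷ k ∷ a ∷ []) ⟩
            4 * M + (2 * M + k) + a    ≡⟨ cong (λ z → 4 * M + z + a) (sym eq) ⟩
            4 * M + (e + i) + a        ≡⟨ solve (M ∷ e ∷ i ∷ a ∷ []) ⟩
            4 * M + i + (a + e)        ∎)
            where open ≡-Reasoning

    U-row : ∀ i → i < M → ∑ M (#U i) ≤ # (window? knight (suc (M + 2 * i)) M) R
    U-row i i<M = ≤-trans (≤-reflexive (∑-swap M R λ k a → χ (U? i k a)))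
      (∑-mono R λ a _ → #-unique-≤χ (λ k → U? i k a) (window? knight (suc (M + 2 * i)) M a) M
        (λ { k l (_ , e) (_ , e′) → +-cancelˡ-≡ (6 * M) k l (+-cancelʳ-≡ (2 * p a) _ _ (trans (sym e) e′)) })
        (λ { k k<M (a∈A , e) → a∈A , in-window k a k<M (trans e (cong (y k +_) (sym (knight-eq a∈A)))) }))
      where
      in-window : ∀ k a {e} → k < M → 2 * (4 * M + i) + a ≡ 6 * M + k + (a + e) → suc (M + 2 * i) ≤ e × e < suc (M + 2 * i) + M
      in-window k a {e} k<M eq =
        ≤-certificate (+-mono-≤ k<M (≤-reflexive eq)) (solve (M ∷ i ∷ k ∷ a ∷ e ∷ [])) ,
        ≤-certificate (+-mono-≤ (z≤n {k}) (≤-reflexive (sym eq))) (solve (M ∷ i ∷ k ∷ a ∷ e ∷ []))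

    T-column : ∀ k → k < M → ∑ M (λ i → #T i k) ≤ # (window? knight (suc (7 * M + 2 * k)) M) R
    T-column k k<M = ≤-trans (≤-reflexive (∑-swap M R λ i a → χ (T? i k a)))
      (∑-mono R λ a _ → #-unique-≤χ (λ i → T? i k a) (window? knight (suc (7 * M + 2 * k)) M a) M
        (λ { i j (_ , e) (_ , e′) → +-cancelˡ-≡ (4 * M) i j (+-cancelʳ-≡ (2 * p a) _ _ (trans (sym e) e′)) })
        (λ { i i<M (a∈A , e) → a∈A , in-window i a i<M (trans e (cong (x i +_) (sym (knight-eq a∈A)))) }))
      where
      in-window : ∀ i a {e} → i < M → 2 * (6 * M + k) + a ≡ 4 * M + i + (a + e) → suc (7 * M + 2 * k) ≤ e × e < suc (7 * M + 2 * k) + M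
      in-window i a {e} i<M eq =
        ≤-certificate (+-mono-≤ i<M (≤-reflexive eq)) (solve (M ∷ i ∷ k ∷ a ∷ e ∷ [])) ,
        ≤-certificate (+-mono-≤ (z≤n {i}) (≤-reflexive (sym eq))) (solve (M ∷ i ∷ k ∷ a ∷ e ∷ []))

-- Numerical tests and their soundness

-- Junk value 0 for division by 0.
infixl 7 _÷_
_÷_ : ℕ → ℕ → ℕ
m ÷ zero  = 0
m ÷ suc n = m / suc n

÷-lower : ∀ m n → m ÷ n * n ≤ m
÷-lower m zero    = z≤n
÷-lower m (suc n) = m/n*n≤m m (suc n)

÷-upper : ∀ m n → 1 ≤ n → m ≤ suc (m ÷ n) * n
÷-upper m (suc n) _ = <⇒≤ (m<[1+m/n]*n m (suc n))

∧-elim : ∀ x {y} → T (x ∧ y) → T x × T y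
∧-elim true t = _ , t

∨-elim : ∀ x {y} → T (x ∨ y) → T x ⊎ T y
∨-elim true  t = inj₁ t
∨-elim false t = inj₂ t

boxInequality : (Q c c′ e⁺ e⁻ eᵤ eₜ : ℕ) → Bool
boxInequality Q c c′ e⁺ e⁻ eᵤ eₜ = (e⁺ + eᵤ ≤ᵇ Q) ∧ (e⁻ + eₜ ≤ᵇ Q) ∧
  (suc (Q * Q) ≤ᵇ (Q ∸ (e⁺ + eᵤ)) * c + (Q ∸ (e⁻ + eₜ)) * c′ + Q * e⁻)

boxTest : (Q c⁻ c⁺ d⁻ d⁺ v⁻ v⁺ : ℕ) → Bool
boxTest Q c⁻ c⁺ d⁻ d⁺ v⁻ v⁺ = boxInequality Q (c⁻ ∸ 4 * (c⁺ ∸ c⁻)) (c⁻ ∸ 6 * (c⁺ ∸ c⁻))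
  (d⁺ + 2 * (d⁺ ∸ d⁻)) (d⁻ ∸ 2 * (d⁺ ∸ d⁻)) (v⁺ + 3 * (v⁺ ∸ v⁻)) (v⁺ + 9 * (v⁺ ∸ v⁻))

-- The three alternatives contradict, in this order, the injectivity of b − a, the injectivity of b − 2a, and
-- the double count in the box.
finalTest : (Q G l u c⁻ c⁺ : ℕ) → Bool
finalTest Q G l u c⁻ c⁺ =
  (suc (Q * (u ∸ G)) ≤ᵇ G * c⁻) ∨
  (suc (Q * ((2 * G ∸ l) + (u ∸ 2 * G))) ≤ᵇ G * c⁻) ∨
  ((2 * G ≤ᵇ l) ∧ boxTest Q c⁻ c⁺ (G * c⁻ ÷ (u ∸ G)) (suc (G * c⁺ ÷ (l ∸ G))) (G * c⁻ ÷ (2 * u ∸ G)) (suc (G * c⁺ ÷ (2 * l ∸ G))))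

-- Each step improves the bounds c⁻ ≤ Q α ≤ c⁺ through α = 1 − (density of B) and l ≤ G b/a ≤ u.
refine : (Q G l u n c⁻ c⁺ : ℕ) → Bool
refine Q G l u zero    c⁻ c⁺ = finalTest Q G l u c⁻ c⁺
refine Q G l u (suc n) c⁻ c⁺ = refine Q G l u n (c⁻ ⊔′ (Q ∸ suc (G * c⁺ ÷ l))) (Q ∸ G * c⁻ ÷ u)

module Contradictions (p : ℕ → ℕ) (isPi : IsPi p) (Q G : ℕ) .{{Q≢0 : NonZero Q}} .{{G≢0 : NonZero G}} where

  open Kernel p isPi
  open Density p isPi Q G
  open Windows p isPi Q G

  Steep Shallow : ℕ → ℕ → Set
  Steep   k₀ l = ∀ a → A a → k₀ ≤ a → l * a ≤ G * p a
  Shallow k₀ u = ∀ a → A a → k₀ ≤ a → G * p a ≤ u * a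

  box-contradiction : ∀ {k₀ e⁺ e⁻ eᵤ eₜ s s′ c c′} → (∀ a → A a → k₀ ≤ a → 2 * a ≤ p a) →
    WindowUpper diagonal 2 e⁺ → WindowLower diagonal 2 e⁻ → WindowUpper knight 3 eᵤ → WindowUpper knight 9 eₜ →
    SegmentLower 4 c → SegmentLower 6 c′ → s + e⁺ + eᵤ ≡ Q → s′ + e⁻ + eₜ ≡ Q →
    ¬ (Q * Q < s * c + s′ * c′ + Q * e⁻)
  box-contradiction {k₀} {e⁺} {e⁻} {eᵤ} {eₜ} {s} {s′} {c} {c′} steep (K₁ , D≤) (K₂ , D≥) (K₃ , U≤) (K₄ , T≤) (K₅ , a≥) (K₆ , a′≥) es es′ test =
    <⇒≱ (≤-refl {M}) (≤-trans
      (box-bound {Q} {M} {e⁺ = e⁺} {e⁻} {eᵤ} {eₜ} {s} {s′} {c} {c′} {K} (total 4) (total 6) es es′ summed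
        (weaken′ {y = Q * ∑ M α} K₅≤K (a≥ M)) (weaken′ {y = Q * ∑ M α′} K₆≤K (a′≥ M)) test)
      (m≤m+n N (2 * k₀)))
    where
    K = K₁ + K₂ + K₃ + K₄ + K₅ + K₆
    K₆≤K : K₆ ≤ K
    K₆≤K = m≤n+m _ _
    K₅≤K : K₅ ≤ K
    K₅≤K = ≤-trans (m≤n+m K₅ _) (m≤m+n _ K₆)
    K₄≤K : K₄ ≤ K
    K₄≤K = ≤-trans (m≤n+m K₄ _) (≤-trans (m≤m+n _ K₅) (m≤m+n _ K₆))
    K₃≤K : K₃ ≤ K
    K₃≤K = ≤-trans (m≤n+m K₃ _) (≤-trans (m≤m+n _ K₄) (≤-trans (m≤m+n _ K₅) (m≤m+n _ K₆)))
    K₂≤K : K₂ ≤ K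
    K₂≤K = ≤-trans (m≤n+m K₂ _) (≤-trans (m≤m+n _ K₃) (≤-trans (m≤m+n _ K₄) (≤-trans (m≤m+n _ K₅) (m≤m+n _ K₆))))
    K₁≤K : K₁ ≤ K
    K₁≤K = ≤-trans (m≤m+n K₁ K₂) (≤-trans (m≤m+n _ K₃) (≤-trans (m≤m+n _ K₄) (≤-trans (m≤m+n _ K₅) (m≤m+n _ K₆))))
    N = 3 * Q * K + s * K + s′ * K
    M = suc (N + 2 * k₀)
    open Box k₀ steep M (s≤s (m≤n+m (2 * k₀) N))
    weaken : ∀ {w e K′} → K′ ≤ K → w ≤ e * M + K′ → w ≤ e * M + K
    weaken K′≤K h = ≤-trans h (+-monoʳ-≤ _ K′≤K)
    weaken′ : ∀ {x y K′} → K′ ≤ K → x ≤ y + K′ → x ≤ y + K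
    weaken′ {y = y} K′≤K h = ≤-trans h (+-monoʳ-≤ y K′≤K)
    in-range : ∀ {t} → t ≤ 10 * M → G * t ≤ R
    in-range = *-monoʳ-≤ G
    D-start : ∀ i → 2 * M ∸ i ≤ 2 * M
    D-start i = m∸n≤m (2 * M) i
    2M≤10M : 2 * M ≤ 10 * M
    2M≤10M = *-monoˡ-≤ M {2} {10} (s≤s (s≤s z≤n))
    3M≤10M : 3 * M ≤ 10 * M
    3M≤10M = *-monoˡ-≤ M {3} {10} (s≤s (s≤s (s≤s z≤n)))
    9M≤10M : 9 * M ≤ 10 * M
    9M≤10M = *-monoˡ-≤ M {9} {10} (n≤1+n 9)
    D-end : ∀ m k → k < m → suc (m + k) ≤ 2 * m
    D-end m k h = ≤-certificate h (solve (m ∷ k ∷ []))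
    U-start : ∀ m i → i < m → suc (m + 2 * i) ≤ 3 * m
    U-start m i h = ≤-certificate (+-mono-≤ h (<⇒≤ h)) (solve (m ∷ i ∷ []))
    T-start : ∀ m k → k < m → suc (7 * m + 2 * k) ≤ 9 * m
    T-start m k h = ≤-certificate (+-mono-≤ h (<⇒≤ h)) (solve (m ∷ k ∷ []))
    D-top : ∀ m k → k < m → suc (m + k) + m ≤ 10 * m
    D-top m k h = ≤-certificate (+-mono-≤ h (z≤n {7 * m})) (solve (m ∷ k ∷ []))
    summed : Q * (∑ M α * ∑ M α′) + ∑ M β′ * (e⁻ * M) ≤
      ∑ M α * ((e⁺ * M + K) + (eᵤ * M + K)) + Q * (∑ M β * ∑ M β′) + ∑ M α′ * (eₜ * M + K) + ∑ M β′ * K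
    summed = box-sum Q M α β α′ β′ #D #U #T pointwise
      (λ i i<M → ≤-trans (*-monoʳ-≤ Q (D-row i i<M))
        (weaken {e = e⁺} K₁≤K (D≤ R (2 * M ∸ i) M (D-start i) (in-range (≤-trans (D-start i) 2M≤10M)))))
      (λ k k<M → ≤-trans (weaken′ {y = Q * # (window? diagonal (suc (M + k)) M) R} K₂≤K
          (D≥ R (suc (M + k)) M (D-end M k k<M) (in-range (D-top M k k<M))))
        (+-monoˡ-≤ K (*-monoʳ-≤ Q (D-column k k<M))))
      (λ i i<M → ≤-trans (*-monoʳ-≤ Q (U-row i i<M))
        (weaken {e = eᵤ} K₃≤K (U≤ R (suc (M + 2 * i)) M (U-start M i i<M) (in-range (≤-trans (U-start M i i<M) 3M≤10M)))))
      (λ k k<M → ≤-trans (*-monoʳ-≤ Q (T-column k k<M))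
        (weaken {e = eₜ} K₄≤K (T≤ R (suc (7 * M + 2 * k)) M (T-start M k k<M) (in-range (≤-trans (T-start M k k<M) 9M≤10M)))))

  boxInequality-sound : ∀ {k₀ e⁺ e⁻ eᵤ eₜ c c′} → (∀ a → A a → k₀ ≤ a → 2 * a ≤ p a) →
    WindowUpper diagonal 2 e⁺ → WindowLower diagonal 2 e⁻ → WindowUpper knight 3 eᵤ → WindowUpper knight 9 eₜ →
    SegmentLower 4 c → SegmentLower 6 c′ → ¬ T (boxInequality Q c c′ e⁺ e⁻ eᵤ eₜ)
  boxInequality-sound {k₀} {e⁺} {e⁻} {eᵤ} {eₜ} {c} {c′} steep h₁ h₂ h₃ h₄ h₅ h₆ t
    with ∧-elim (e⁺ + eᵤ ≤ᵇ Q) t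
  ... | t₁ , t₂₃ with ∧-elim (e⁻ + eₜ ≤ᵇ Q) t₂₃
  ... | t₂ , t₃ = box-contradiction {s = Q ∸ (e⁺ + eᵤ)} {Q ∸ (e⁻ + eₜ)} {c} {c′} steep h₁ h₂ h₃ h₄ h₅ h₆
    (trans (+-assoc _ e⁺ eᵤ) (m∸n+n≡m (≤ᵇ⇒≤ (e⁺ + eᵤ) Q t₁))) (trans (+-assoc _ e⁻ eₜ) (m∸n+n≡m (≤ᵇ⇒≤ (e⁻ + eₜ) Q t₂)))
    (≤ᵇ⇒≤ (suc (Q * Q)) _ t₃)

  boxTest-sound : ∀ {k₀ c⁻ c⁺ d⁻ d⁺ v⁻ v⁺} → (∀ a → A a → k₀ ≤ a → 2 * a ≤ p a) →
    Lower c⁻ → Upper c⁺ → LowerCum diagonal d⁻ → UpperCum diagonal d⁺ → LowerCum knight v⁻ → UpperCum knight v⁺ →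
    ¬ T (boxTest Q c⁻ c⁺ d⁻ d⁺ v⁻ v⁺)
  boxTest-sound {k₀} {c⁻} {c⁺} {d⁻} {d⁺} {v⁻} {v⁺} steep hc⁻ hc⁺ hd⁻ hd⁺ hv⁻ hv⁺ = boxInequality-sound
    {e⁺ = d⁺ + 2 * (d⁺ ∸ d⁻)} {d⁻ ∸ 2 * (d⁺ ∸ d⁻)} {v⁺ + 3 * (v⁺ ∸ v⁻)} {v⁺ + 9 * (v⁺ ∸ v⁻)}
    {c⁻ ∸ 4 * (c⁺ ∸ c⁻)} {c⁻ ∸ 6 * (c⁺ ∸ c⁻)} steep
    (windowUpper {φ⁻ = d⁻} {d⁺} 2 hd⁻ hd⁺) (windowLower {φ⁻ = d⁻} {d⁺} 2 hd⁻ hd⁺)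
    (windowUpper {φ⁻ = v⁻} {v⁺} 3 hv⁻ hv⁺) (windowUpper {φ⁻ = v⁻} {v⁺} 9 hv⁻ hv⁺)
    (segmentLower {c⁻} {c⁺} 4 hc⁻ hc⁺) (segmentLower {c⁻} {c⁺} 6 hc⁻ hc⁺)

  steep-diagonal : ∀ {k₀ l} → Steep k₀ l → ∀ a → A a → k₀ ≤ a → (l ∸ G) * a ≤ G * diagonal a
  steep-diagonal {l = l} steep a a∈A k₀≤a = begin
    (l ∸ G) * a          ≡⟨ *-distribʳ-∸ a l G ⟩
    l * a ∸ G * a        ≤⟨ ∸-monoˡ-≤ (G * a) (steep a a∈A k₀≤a) ⟩
    G * p a ∸ G * a      ≡⟨ sym (*-distribˡ-∸ G (p a) a) ⟩
    G * diagonal a       ∎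
    where open ≤-Reasoning

  shallow-diagonal : ∀ {k₀ u} → Shallow k₀ u → ∀ a → A a → k₀ ≤ a → G * diagonal a ≤ (u ∸ G) * a
  shallow-diagonal {u = u} shallow a a∈A k₀≤a = begin
    G * diagonal a       ≡⟨ *-distribˡ-∸ G (p a) a ⟩
    G * p a ∸ G * a      ≤⟨ ∸-monoˡ-≤ (G * a) (shallow a a∈A k₀≤a) ⟩
    u * a ∸ G * a        ≡⟨ sym (*-distribʳ-∸ a u G) ⟩
    (u ∸ G) * a          ∎
    where open ≤-Reasoning

  swap-double : ∀ q → 2 * (G * q) ≡ G * (2 * q)
  swap-double q = solve (q ∷ G ∷ [])

  steep-knight : ∀ {k₀ l} → Steep k₀ l → ∀ a → A a → k₀ ≤ a → (2 * l ∸ G) * a ≤ G * knight a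
  steep-knight {l = l} steep a a∈A k₀≤a = begin
    (2 * l ∸ G) * a            ≡⟨ *-distribʳ-∸ a (2 * l) G ⟩
    2 * l * a ∸ G * a          ≡⟨ cong (_∸ G * a) (*-assoc 2 l a) ⟩
    2 * (l * a) ∸ G * a        ≤⟨ ∸-monoˡ-≤ (G * a) (*-monoʳ-≤ 2 (steep a a∈A k₀≤a)) ⟩
    2 * (G * p a) ∸ G * a      ≡⟨ cong (_∸ G * a) (swap-double (p a)) ⟩
    G * (2 * p a) ∸ G * a      ≡⟨ sym (*-distribˡ-∸ G (2 * p a) a) ⟩
    G * knight a               ∎
    where open ≤-Reasoning

  shallow-knight : ∀ {k₀ u} → Shallow k₀ u → ∀ a → A a → k₀ ≤ a → G * knight a ≤ (2 * u ∸ G) * a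
  shallow-knight {u = u} shallow a a∈A k₀≤a = begin
    G * knight a               ≡⟨ *-distribˡ-∸ G (2 * p a) a ⟩
    G * (2 * p a) ∸ G * a      ≡⟨ cong (_∸ G * a) (sym (swap-double (p a))) ⟩
    2 * (G * p a) ∸ G * a      ≤⟨ ∸-monoˡ-≤ (G * a) (*-monoʳ-≤ 2 (shallow a a∈A k₀≤a)) ⟩
    2 * (u * a) ∸ G * a        ≡⟨ cong (_∸ G * a) (sym (*-assoc 2 u a)) ⟩
    2 * u * a ∸ G * a          ≡⟨ sym (*-distribʳ-∸ a (2 * u) G) ⟩
    (2 * u ∸ G) * a            ∎
    where open ≤-Reasoning

  steep-double : ∀ {k₀ l} → 2 * G ≤ l → Steep k₀ l → ∀ a → A a → k₀ ≤ a → 2 * a ≤ p a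
  steep-double {l = l} 2G≤l steep a a∈A k₀≤a = *-cancelˡ-≤ G (begin
    G * (2 * a)      ≡⟨ sym (trans (*-assoc 2 G a) (swap-double a)) ⟩
    2 * G * a        ≤⟨ *-monoˡ-≤ a 2G≤l ⟩
    l * a            ≤⟨ steep a a∈A k₀≤a ⟩
    G * p a          ∎)
    where open ≤-Reasoning

  diagonal-contradiction : ∀ {k₀ u c} → Shallow k₀ u → Lower c → ¬ (Q * (u ∸ G) < G * c)
  diagonal-contradiction {k₀} {u} shallow = crowding {k₀ = k₀} (λ _ → diagonal) into inj
    where
    into : ∀ n a → a < G * n → A a → k₀ ≤ a → diagonal a ≤ (u ∸ G) * n
    into n a a<Gn a∈A k₀≤a = *-cancelˡ-≤ G (begin
      G * diagonal a         ≤⟨ shallow-diagonal shallow a a∈A k₀≤a ⟩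
      (u ∸ G) * a            ≤⟨ *-monoʳ-≤ (u ∸ G) (<⇒≤ a<Gn) ⟩
      (u ∸ G) * (G * n)      ≡⟨ shape (u ∸ G) G n ⟩
      G * ((u ∸ G) * n)      ∎)
      where
      open ≤-Reasoning
      shape : ∀ x y z → x * (y * z) ≡ y * (x * z)
      shape = solve-∀
    inj : ∀ n i j → i < G * n → A i → k₀ ≤ i → j < G * n → A j → k₀ ≤ j → diagonal i ≡ diagonal j → i ≡ j
    inj n i j _ i∈A _ _ j∈A _ e = injective₁ i j (arith (diagonal-eq i∈A) (trans (cong (j +_) e) (diagonal-eq j∈A)))
      where
      arith : ∀ {q r d} → i + d ≡ q → j + d ≡ r → q + j ≡ r + i
      arith {d = d} refl refl = solve (i ∷ j ∷ d ∷ [])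

  -- The values b − 2a for a < G n lie in an interval of length about (z + z′) n.
  steep-diagonal-contradiction : ∀ {k₀ l u c} → Steep k₀ l → Shallow k₀ u → Lower c →
    ¬ (Q * ((2 * G ∸ l) + (u ∸ 2 * G)) < G * c)
  steep-diagonal-contradiction {k₀} {l} {u} steep shallow =
    crowding {k₀ = k₀} (λ n a → p a + z * n ∸ 2 * a) into inj
    where
    z = 2 * G ∸ l
    z′ = u ∸ 2 * G
    low : ∀ n a → a < G * n → A a → k₀ ≤ a → 2 * a ≤ p a + z * n
    low n a a<Gn a∈A k₀≤a = *-cancelˡ-≤ G (begin
      G * (2 * a)                  ≡⟨ sym (trans (*-assoc 2 G a) (swap-double a)) ⟩
      2 * G * a                    ≤⟨ *-monoˡ-≤ a (m≤n+m∸n (2 * G) l) ⟩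
      (l + z) * a                  ≡⟨ *-distribʳ-+ a l z ⟩
      l * a + z * a                ≤⟨ +-mono-≤ (steep a a∈A k₀≤a) (*-monoʳ-≤ z (<⇒≤ a<Gn)) ⟩
      G * p a + z * (G * n)        ≡⟨ shape G (p a) z n ⟩
      G * (p a + z * n)            ∎)
      where
      open ≤-Reasoning
      shape : ∀ g q z n → g * q + z * (g * n) ≡ g * (q + z * n)
      shape = solve-∀
    into : ∀ n a → a < G * n → A a → k₀ ≤ a → p a + z * n ∸ 2 * a ≤ (z + z′) * n
    into n a a<Gn a∈A k₀≤a = m≤n+o⇒m∸n≤o (p a + z * n) (2 * a) (*-cancelˡ-≤ G (begin
      G * (p a + z * n)                      ≡⟨ *-distribˡ-+ G (p a) (z * n) ⟩
      G * p a + G * (z * n)                  ≤⟨ +-monoˡ-≤ _ (shallow a a∈A k₀≤a) ⟩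
      u * a + G * (z * n)                    ≤⟨ +-monoˡ-≤ _ (*-monoˡ-≤ a (m≤n+m∸n u (2 * G))) ⟩
      (2 * G + z′) * a + G * (z * n)         ≡⟨ cong (_+ G * (z * n)) (*-distribʳ-+ a (2 * G) z′) ⟩
      2 * G * a + z′ * a + G * (z * n)       ≤⟨ +-monoˡ-≤ _ (+-monoʳ-≤ (2 * G * a) (*-monoʳ-≤ z′ (<⇒≤ a<Gn))) ⟩
      2 * G * a + z′ * (G * n) + G * (z * n) ≡⟨ shape G a z′ n z ⟩
      G * (2 * a + (z + z′) * n)             ∎))
      where
      open ≤-Reasoning
      shape : ∀ g a y n z → 2 * g * a + y * (g * n) + g * (z * n) ≡ g * (2 * a + (z + y) * n)
      shape = solve-∀
    inj : ∀ n i j → i < G * n → A i → k₀ ≤ i → j < G * n → A j → k₀ ≤ j →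
      p i + z * n ∸ 2 * i ≡ p j + z * n ∸ 2 * j → i ≡ j
    inj n i j i< i∈A k₀≤i j< j∈A k₀≤j e = injective₂ i j
      (arith (p i) (p j) (z * n) (m+[n∸m]≡n (low n i i< i∈A k₀≤i)) (trans (cong (2 * j +_) e) (m+[n∸m]≡n (low n j j< j∈A k₀≤j))))
      where
      arith : ∀ q r w {d} → 2 * i + d ≡ q + w → 2 * j + d ≡ r + w → q + 2 * j ≡ r + 2 * i
      arith q r w {d} h h′ = +-cancelʳ-≡ (w + d) _ _ (begin
        q + 2 * j + (w + d)        ≡⟨ solve (q ∷ j ∷ w ∷ d ∷ []) ⟩
        (q + w) + (2 * j + d)      ≡⟨ cong₂ _+_ (sym h) h′ ⟩
        (2 * i + d) + (r + w)      ≡⟨ solve (r ∷ i ∷ w ∷ d ∷ []) ⟩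
        r + 2 * i + (w + d)        ∎)
        where open ≡-Reasoning

  finalTest-sound : ∀ {k₀ l u c⁻ c⁺} → l ≤ u → Steep k₀ l → Shallow k₀ u → Lower c⁻ → Upper c⁺ →
    ¬ T (finalTest Q G l u c⁻ c⁺)
  finalTest-sound {k₀} {l} {u} {c⁻} {c⁺} l≤u steep shallow lower upper t
    with ∨-elim (suc (Q * (u ∸ G)) ≤ᵇ G * c⁻) t
  ... | inj₁ t₁ = diagonal-contradiction {k₀} {u} {c⁻} shallow lower (≤ᵇ⇒≤ (suc (Q * (u ∸ G))) (G * c⁻) t₁)
  ... | inj₂ t₂₃ with ∨-elim (suc (Q * ((2 * G ∸ l) + (u ∸ 2 * G))) ≤ᵇ G * c⁻) t₂₃
  ... | inj₁ t₂ = steep-diagonal-contradiction {k₀} {l} {u} {c⁻} steep shallow lower (≤ᵇ⇒≤ (suc (Q * ((2 * G ∸ l) + (u ∸ 2 * G)))) (G * c⁻) t₂)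
  ... | inj₂ t₃ with ∧-elim (2 * G ≤ᵇ l) t₃
  ... | t₄ , t₅ = boxTest-sound {k₀} {c⁻} {c⁺} {d⁻} {d⁺} {v⁻} {v⁺} (steep-double {l = l} 2G≤l steep) lower upper
    (lowerCum {diagonal} {u ∸ G} {c⁻} {d⁻} (shallow-diagonal {u = u} shallow) (≤-trans 1≤l∸G (∸-monoˡ-≤ G l≤u)) lower (÷-lower (G * c⁻) (u ∸ G)))
    (upperCum {diagonal} {l ∸ G} {c⁺} {d⁺} (steep-diagonal {l = l} steep) 1≤l∸G upper (÷-upper (G * c⁺) (l ∸ G) 1≤l∸G))
    (lowerCum {knight} {2 * u ∸ G} {c⁻} {v⁻} (shallow-knight {u = u} shallow) (≤-trans 1≤2l∸G (∸-monoˡ-≤ G (*-monoʳ-≤ 2 l≤u))) lower (÷-lower (G * c⁻) (2 * u ∸ G)))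
    (upperCum {knight} {2 * l ∸ G} {c⁺} {v⁺} (steep-knight {l = l} steep) 1≤2l∸G upper (÷-upper (G * c⁺) (2 * l ∸ G) 1≤2l∸G))
    t₅
    where
    d⁻ = G * c⁻ ÷ (u ∸ G)
    d⁺ = suc (G * c⁺ ÷ (l ∸ G))
    v⁻ = G * c⁻ ÷ (2 * u ∸ G)
    v⁺ = suc (G * c⁺ ÷ (2 * l ∸ G))
    2G≤l : 2 * G ≤ l
    2G≤l = ≤ᵇ⇒≤ (2 * G) l t₄
    1≤l∸G : 1 ≤ l ∸ G
    1≤l∸G = ≤-trans (>-nonZero⁻¹ G) (m+n≤o⇒m≤o∸n G (≤-trans (≤-reflexive (cong (G +_) (sym (+-identityʳ G)))) 2G≤l))
    1≤2l∸G : 1 ≤ 2 * l ∸ G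
    1≤2l∸G = ≤-trans 1≤l∸G (∸-monoˡ-≤ G (m≤m+n l _))

  refine-sound : ∀ {k₀ l u} n {c⁻ c⁺} → 1 ≤ l → l ≤ u → Steep k₀ l → Shallow k₀ u → Lower c⁻ → Upper c⁺ →
    ¬ T (refine Q G l u n c⁻ c⁺)
  refine-sound zero    {c⁻} {c⁺} 1≤l l≤u steep shallow lower upper = finalTest-sound {c⁻ = c⁻} {c⁺} l≤u steep shallow lower upper
  refine-sound {k₀} {l} {u} (suc n) {c⁻} {c⁺} 1≤l l≤u steep shallow lower upper =
    refine-sound n {c⁻ ⊔′ (Q ∸ φ⁺)} {Q ∸ φ⁻} 1≤l l≤u steep shallow
      (lower-⊔′ {c⁻} {Q ∸ φ⁺} lower (lower-of-cum {φ⁺} (upperCum {p} {l} {c⁺} {φ⁺} steep 1≤l upper (÷-upper (G * c⁺) l 1≤l))))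
      (upper-of-cum {φ⁻} (lowerCum {p} {u} {c⁻} {φ⁻} shallow (≤-trans 1≤l l≤u) lower (÷-lower (G * c⁻) u)))
    where
    φ⁺ = suc (G * c⁺ ÷ l)
    φ⁻ = G * c⁻ ÷ u

-- Convergence of the ratios

allBelow : (ℕ → Bool) → ℕ → Bool
allBelow f zero    = true
allBelow f (suc n) = f n ∧ allBelow f n

allBelow-sound : ∀ f n → T (allBelow f n) → ∀ i → i < n → T (f i)
allBelow-sound f (suc n) t i i<1+n with ∧-elim (f n) t | m≤n⇒m<n∨m≡n (≤-pred i<1+n)
... | _ , t′ | inj₁ i<n  = allBelow-sound f n t′ i i<n
... | t′ , _ | inj₂ refl = t′

steepTest : (Q G l : ℕ) → Bool
steepTest Q G l = (2 * G ≤ᵇ l) ∧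
  boxTest Q (Q ∸ suc (G * Q ÷ l)) Q 0 (suc (G * Q ÷ (l ∸ G))) 0 (suc (G * Q ÷ (2 * l ∸ G)))

ratioTest : (Q G steps j : ℕ) → Bool
ratioTest Q G steps j = (j <ᵇ G) ∨ refine Q G (j ∸ 1) (j + 2) steps (Q / 2) Q

∣⊖∣-bound : ∀ {x y g w} → ℤ.∣ x ⊖ y ∣ * g < w → x * g < y * g + w
∣⊖∣-bound {x} {y} {g} {w} h with ≤-total x y
... | inj₁ x≤y = ≤-<-trans (*-monoˡ-≤ g x≤y) (m<m+n (y * g) (≤-<-trans z≤n h))
... | inj₂ y≤x = begin-strict
  x * g                          ≡⟨ cong (_* g) (sym (m+[n∸m]≡n y≤x)) ⟩
  (y + (x ∸ y)) * g              ≡⟨ *-distribʳ-+ g y (x ∸ y) ⟩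
  y * g + (x ∸ y) * g            ≡⟨ cong (λ k → y * g + ℤ.∣ k ∣ * g) (sym (ℤₚ.⊖-≥ y≤x)) ⟩
  y * g + ℤ.∣ x ⊖ y ∣ * g        <⟨ +-monoʳ-< (y * g) h ⟩
  y * g + w                      ∎
  where open ≤-Reasoning

∣-∣<⇒ : ∀ b d b₀ d₀ g → ℚ.∣ mkℚᵘ (pos b) d ℚ.- mkℚᵘ (pos b₀) d₀ ∣ <ℚ mkℚᵘ (pos 1) g →
  (b * suc d₀ * suc g < b₀ * suc d * suc g + suc d * suc d₀) ×
  (b₀ * suc d * suc g < b * suc d₀ * suc g + suc d * suc d₀)
∣-∣<⇒ b d b₀ d₀ g (*<* lt) = ∣⊖∣-bound {x} {y} h , ∣⊖∣-bound {y} {x} (subst (λ k → k * suc g < suc d * suc d₀) (ℤₚ.∣m⊖n∣≡∣n⊖m∣ x y) h)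
  where
  x = b * suc d₀
  y = b₀ * suc d
  numerator : pos b ℤ.* pos (suc d₀) ℤ.+ (ℤ.- (pos b₀)) ℤ.* pos (suc d) ≡ x ⊖ y
  numerator = begin
    pos b ℤ.* pos (suc d₀) ℤ.+ (ℤ.- (pos b₀)) ℤ.* pos (suc d)     ≡⟨ cong₂ ℤ._+_ (sym (ℤₚ.pos-* b (suc d₀))) (sym (ℤₚ.neg-distribˡ-* (pos b₀) (pos (suc d)))) ⟩
    pos x ℤ.+ ℤ.- (pos b₀ ℤ.* pos (suc d))                    ≡⟨ cong (λ k → pos x ℤ.+ ℤ.- k) (sym (ℤₚ.pos-* b₀ (suc d))) ⟩
    pos x ℤ.- pos y                                       ≡⟨ ℤₚ.m-n≡m⊖n x y ⟩
    x ⊖ y                                             ∎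
    where open ≡-Reasoning
  h : ℤ.∣ x ⊖ y ∣ * suc g < suc d * suc d₀
  h = ℤₚ.drop‿+<+ (subst₂ ℤ._<_
    (trans (sym (ℤₚ.pos-* ℤ.∣ pos b ℤ.* pos (suc d₀) ℤ.+ (ℤ.- (pos b₀)) ℤ.* pos (suc d) ∣ (suc g))) (cong (λ k → pos (ℤ.∣ k ∣ * suc g)) numerator))
    (ℤₚ.*-identityˡ (pos (suc d * suc d₀))) lt)

module Nonconvergence (p a : ℕ → ℕ) (isPi : IsPi p) (isIncEnum : IsIncEnum p a)
  (Q g steps top : ℕ) .{{Q≢0 : NonZero Q}} (1≤g : 1 ≤ g)
  (ratioTests : T (allBelow (ratioTest Q (suc g) steps) top)) (steep-test : T (steepTest Q (suc g) (top ∸ 1))) where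

  G = suc g

  open Density p isPi Q G
  open Windows p isPi Q G using (diagonal; knight)
  open Contradictions p isPi Q G

  a-mono : ∀ {m n} → m ≤ n → a m ≤ a n
  a-mono {m} {n} m≤n with m≤n⇒m<n∨m≡n m≤n
  ... | inj₂ refl = ≤-refl
  a-mono {m} {suc n} _ | inj₁ (s≤s m≤n) = ≤-trans (a-mono m≤n) (<⇒≤ (proj₁ isIncEnum n))

  tail : ∀ {P : ℕ → Set} N → (∀ n → N ≤ n → P (a (suc n))) → ∀ k → A k → suc (a (suc N)) ≤ k → P k
  tail {P} N h k k∈A N<k with proj₁ (proj₂ isIncEnum k) k∈A
  ... | n , refl with suc N <? n
  ...   | no  N≮n = ⊥-elim (<⇒≱ N<k (a-mono (≮⇒≥ N≮n)))
  ...   | yes (s≤s N<n) = h _ (<⇒≤ N<n)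

  denominator : ∀ n → suc (a (suc n) ∸ 1) ≡ a (suc n)
  denominator n = m+[n∸m]≡n (≤-<-trans z≤n (proj₁ isIncEnum n))

  a∈A : ∀ n → A (a n)
  a∈A n = proj₂ (proj₂ isIncEnum (a n)) n refl

  no-steep : ∀ {k₀} → ¬ Steep k₀ (top ∸ 1)
  no-steep {k₀} steep with ∧-elim (2 * G ≤ᵇ top ∸ 1) steep-test
  ... | t₁ , t₂ = boxTest-sound {k₀} {c⁻} {Q} {0} {d⁺} {0} {v⁺} (steep-double {l = l} 2G≤l steep)
    (lower-of-cum {suc (G * Q ÷ l)} (upperCum {p} {l} {Q} {suc (G * Q ÷ l)} steep 1≤l upper-trivial (÷-upper (G * Q) l 1≤l))) upper-trivial
    (0 , λ _ _ _ → z≤n) (upperCum {diagonal} {l ∸ G} {Q} {d⁺} (steep-diagonal {l = l} steep) 1≤l∸G upper-trivial (÷-upper (G * Q) (l ∸ G) 1≤l∸G))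
    (0 , λ _ _ _ → z≤n) (upperCum {knight} {2 * l ∸ G} {Q} {v⁺} (steep-knight {l = l} steep) 1≤2l∸G upper-trivial (÷-upper (G * Q) (2 * l ∸ G) 1≤2l∸G))
    t₂
    where
    l = top ∸ 1
    c⁻ = Q ∸ suc (G * Q ÷ l)
    d⁺ = suc (G * Q ÷ (l ∸ G))
    v⁺ = suc (G * Q ÷ (2 * l ∸ G))
    2G≤l : 2 * G ≤ l
    2G≤l = ≤ᵇ⇒≤ (2 * G) l t₁
    1≤l : 1 ≤ l
    1≤l = ≤-trans (s≤s z≤n) 2G≤l
    1≤l∸G : 1 ≤ l ∸ G
    1≤l∸G = ≤-trans (s≤s z≤n) (m+n≤o⇒m≤o∸n G (≤-trans (≤-reflexive (cong (λ k → G + k) (sym (+-identityʳ G)))) 2G≤l))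
    1≤2l∸G : 1 ≤ 2 * l ∸ G
    1≤2l∸G = ≤-trans 1≤l∸G (∸-monoˡ-≤ G (m≤m+n l _))

  no-ratio : ∀ {k₀} j → G ≤ j → j < top → Steep k₀ (j ∸ 1) → ¬ Shallow k₀ (j + 2)
  no-ratio {k₀} j G≤j j<top steep shallow
    with ∨-elim (j <ᵇ G) (allBelow-sound (ratioTest Q G steps) top ratioTests j j<top)
  ... | inj₁ t = <⇒≱ (<ᵇ⇒< j G t) G≤j
  ... | inj₂ t = refine-sound {k₀} {j ∸ 1} {j + 2} steps {Q / 2} {Q}
    (≤-trans 1≤g (∸-monoˡ-≤ 1 G≤j)) (≤-trans (m∸n≤m j 1) (m≤m+n j 2)) steep shallow
    (lower-half {Q / 2} (≤-trans (≤-reflexive (*-comm 2 (Q / 2))) (m/n*n≤m Q 2))) upper-trivial t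

  steep-tail : ∀ {l N} → (∀ n → N ≤ n → l * suc (a (suc n) ∸ 1) ≤ G * p (a (suc n))) → Steep (suc (a (suc N))) l
  steep-tail {l} {N} h = tail {λ k → l * k ≤ G * p k} N
    (λ n N≤n → subst (λ k → l * k ≤ G * p (a (suc n))) (denominator n) (h n N≤n))

  shallow-tail : ∀ {u N} → (∀ n → N ≤ n → G * p (a (suc n)) ≤ u * suc (a (suc n) ∸ 1)) → Shallow (suc (a (suc N))) u
  shallow-tail {u} {N} h = tail {λ k → G * p k ≤ u * k} N
    (λ n N≤n → subst (λ k → G * p (a (suc n)) ≤ u * k) (denominator n) (h n N≤n))

  ¬infinite : ¬ TendsToInfinity (ratio p a)
  ¬infinite tends with tends (mkℚᵘ (pos top) 0)
  ... | N , large = no-steep (steep-tail {top ∸ 1} {N} λ n N≤n → step (a (suc n) ∸ 1) (p (a (suc n))) (large n N≤n))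
    where
    step : ∀ d b → mkℚᵘ (pos top) 0 <ℚ mkℚᵘ (pos b) d → (top ∸ 1) * suc d ≤ G * b
    step d b (*<* lt) = ≤-trans (*-monoˡ-≤ (suc d) (m∸n≤m top 1)) (≤-trans (<⇒≤
      (ℤₚ.drop‿+<+ (subst₂ ℤ._<_ (sym (ℤₚ.pos-* top (suc d))) (ℤₚ.*-identityʳ (pos b)) lt))) (m≤n*m b G))

  ¬cauchy : ¬ Cauchy (ratio p a)
  ¬cauchy cauchy with cauchy (mkℚᵘ (pos 1) g) (*<* (ℤ.+<+ (s≤s z≤n)))
  ... | N , close = conclude (j <? top)
    where
    b₀ d₀ j : ℕ
    b₀ = p (a (suc N))
    d₀ = a (suc N) ∸ 1
    j  = G * b₀ / suc d₀
    bounds : ∀ n → N ≤ n → let b = p (a (suc n)) ; d = a (suc n) ∸ 1 in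
      (b * suc d₀ * G < b₀ * suc d * G + suc d * suc d₀) × (b₀ * suc d * G < b * suc d₀ * G + suc d * suc d₀)
    bounds n N≤n = ∣-∣<⇒ (p (a (suc n))) (a (suc n) ∸ 1) b₀ d₀ g (close n N N≤n ≤-refl)
    j-lower : j * suc d₀ ≤ G * b₀
    j-lower = m/n*n≤m (G * b₀) (suc d₀)
    j-upper : G * b₀ < suc j * suc d₀
    j-upper = m<[1+m/n]*n (G * b₀) (suc d₀)
    G≤j : G ≤ j
    G≤j = ≤-pred (*-cancelʳ-< (suc d₀) G (suc j) (≤-<-trans
      (*-monoʳ-≤ G (≤-trans (≤-reflexive (denominator N)) (a∈A (suc N)))) j-upper))
    below-ratio : ∀ t → t ≤ j → Steep (suc (a (suc N))) (t ∸ 1)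
    below-ratio t t≤j = steep-tail {t ∸ 1} {N} λ n N≤n → arith (p (a (suc n))) (suc (a (suc n) ∸ 1)) (proj₂ (bounds n N≤n))
      where
      arith : ∀ b D → b₀ * D * G < b * suc d₀ * G + D * suc d₀ → (t ∸ 1) * D ≤ G * b
      arith b D h = ≤-trans (≤-reflexive (trans (*-distribʳ-∸ D t 1) (cong (t * D ∸_) (*-identityˡ D))))
        (m≤n+o⇒m∸n≤o (t * D) D (*-cancelʳ-≤ _ _ (suc d₀) (begin
          t * D * suc d₀                    ≤⟨ *-monoˡ-≤ (suc d₀) (*-monoˡ-≤ D t≤j) ⟩
          j * D * suc d₀                    ≡⟨ swapʳ j D (suc d₀) ⟩
          j * suc d₀ * D                    ≤⟨ *-monoˡ-≤ D j-lower ⟩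
          G * b₀ * D                        ≡⟨ rotate G b₀ D ⟩
          b₀ * D * G                        ≤⟨ <⇒≤ h ⟩
          b * suc d₀ * G + D * suc d₀       ≡⟨ shape b (suc d₀) G D ⟩
          (D + G * b) * suc d₀              ∎)))
        where
        open ≤-Reasoning
        swapʳ : ∀ x y z → x * y * z ≡ x * z * y
        swapʳ = solve-∀
        rotate : ∀ x y z → x * y * z ≡ y * z * x
        rotate = solve-∀
        shape : ∀ b e g D → b * e * g + D * e ≡ (D + g * b) * e
        shape = solve-∀
    above-ratio : Shallow (suc (a (suc N))) (j + 2)
    above-ratio = shallow-tail {j + 2} {N} λ n N≤n → arith (p (a (suc n))) (suc (a (suc n) ∸ 1)) (proj₁ (bounds n N≤n))
      where
      arith : ∀ b D → b * suc d₀ * G < b₀ * D * G + D * suc d₀ → G * b ≤ (j + 2) * D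
      arith b D h = *-cancelʳ-≤ _ _ (suc d₀) (begin
        G * b * suc d₀                      ≡⟨ rotate G b (suc d₀) ⟩
        b * suc d₀ * G                      ≤⟨ <⇒≤ h ⟩
        b₀ * D * G + D * suc d₀             ≡⟨ cong (_+ D * suc d₀) (sym (rotate G b₀ D)) ⟩
        G * b₀ * D + D * suc d₀             ≤⟨ +-monoˡ-≤ (D * suc d₀) (*-monoˡ-≤ D (<⇒≤ j-upper)) ⟩
        suc j * suc d₀ * D + D * suc d₀     ≡⟨ shape j (suc d₀) D ⟩
        (j + 2) * D * suc d₀                ∎)
        where
        open ≤-Reasoning
        rotate : ∀ x y z → x * y * z ≡ y * z * x
        rotate = solve-∀
        shape : ∀ j e D → suc j * e * D + D * e ≡ (j + 2) * D * e
        shape = solve-∀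
    conclude : Dec (j < top) → ⊥
    conclude (yes j<top) = no-ratio j G≤j j<top (below-ratio j ≤-refl) above-ratio
    conclude (no  j≮top) = no-steep (below-ratio top (≮⇒≥ j≮top))

-- Ratios are located up to 1/500; from 20 on, the one-sided bound alone suffices.
theorem3p5 : (p a : ℕ → ℕ) → IsPi p → IsIncEnum p a →
    ¬ Cauchy (ratio p a) × ¬ TendsToInfinity (ratio p a)
theorem3p5 p a isPi isIncEnum = ¬cauchy , ¬infinite
  where open Nonconvergence p a isPi isIncEnum 1000000 499 8 10001 (s≤s z≤n) tt tt
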